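{- For all integers $n\geq 0$, $k\geq 1$ and $i\geq 0$, \begin{align*} \bar a_{2^ki+\frac{2^k-6}{2}}(8n+7)&\equiv 0 \pmod{2^{k+3}},\\ \bar a_{2^ki+\frac{2^k-2}{2}}(8n+7)&\equiv 0 \pmod{2^{k+3}}. \end{align*}
   Context: For an integer $k\geq 1$ let $f_k:=\prod_{n\geq 1}(1-q^{kn})$. For an integer $c$, $\bar a_c(n)$ denotes the coefficient of $q^n$ in the power series $\dfrac{f_4^{c-1}}{f_1^2f_2^{2c-3}}$, i.e. $\sum_{n\geq 0}\bar a_c(n)q^n=\dfrac{f_4^{c-1}}{f_1^2f_2^{2c-3}}$ (for $c\geq1$ these are the generalized overcubic partition numbers). -}

module Defs where

open import Data.Nat as ℕ using (ℕ; zero; suc; _∸_; NonZero)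
import Data.Nat.Properties as ℕ
open import Data.Integer using (ℤ; +_; -[1+_]; 0ℤ; 1ℤ; _+_; _-_; _*_; -_)
open import Data.Integer.Properties
  using (+-0-commutativeMonoid; +-identityʳ; +-inverseˡ; *-identityˡ)
open import Data.Fin using (Fin; zero; suc; toℕ)
open import Data.Fin.Properties using (toℕ<n)
open import Data.Vec using (Vec; []; _∷_; head; lookup)
open import Relation.Nullary.Negation using (contradiction)
open import Relation.Binary.PropositionalEquality
  using (_≡_; _≢_; refl; sym; trans; cong; cong₂; module ≡-Reasoning)
open import Algebra.Properties.CommutativeMonoid.Sum +-0-commutativeMonoid
  using (sum; sum-cong-≗; sum-replicate-zero)

-- A formal power series in q over ℤ, given by its coefficients.
Series : Set
Series = ℕ → ℤ

infixl 7 _⊛_ _⊘_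
infixl 6 _⊖_
infixr 8 _^ℕ_ _^ℤ_

q^ : ℕ → Series
q^ zero    zero    = 1ℤ
q^ zero    (suc n) = 0ℤ
q^ (suc d) zero    = 0ℤ
q^ (suc d) (suc n) = q^ d n

𝟙 : Series
𝟙 = q^ 0

_⊖_ : Series → Series → Series
(a ⊖ b) n = a n - b n

_⊛_ : Series → Series → Series
(a ⊛ b) n = sum {suc n} λ j → a (toℕ j) * b (n ∸ toℕ j)

-- The coefficients bₙ, …, b₀ of 1/a, from b₀ = 1 and
-- bₙ₊₁ = - (a₁ bₙ + a₂ bₙ₋₁ + ⋯ + aₙ₊₁ b₀).
-- Meaningful only when a has constant term 1, as in inverse-correct.
inverseCoeffs : Series → (n : ℕ) → Vec ℤ (suc n)
inverseCoeffs a zero    = 1ℤ ∷ []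
inverseCoeffs a (suc n) =
  - sum (λ j → a (suc (toℕ j)) * lookup (inverseCoeffs a n) j) ∷ inverseCoeffs a n

inverse : Series → Series
inverse a n = head (inverseCoeffs a n)

_⊘_ : Series → Series → Series
a ⊘ b = a ⊛ inverse b

_^ℕ_ : Series → ℕ → Series
a ^ℕ zero  = 𝟙
a ^ℕ suc n = a ⊛ a ^ℕ n

_^ℤ_ : Series → ℤ → Series
a ^ℤ (+ n)    = a ^ℕ n
a ^ℤ -[1+ n ] = inverse (a ^ℕ suc n)

-- ∏ (1 - q^(k n)) over 1 ≤ n ≤ N
partialProduct : ℕ → ℕ → Series
partialProduct k zero    = 𝟙
partialProduct k (suc N) = (𝟙 ⊖ q^ (k ℕ.* suc N)) ⊛ partialProduct k N

-- The infinite product ∏ (1 - q^(k n)) over n ≥ 1: for k ≥ 1 the factors with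
-- n > m do not affect the coefficient of q^m, see f-limit.
f : ℕ → Series
f k m = partialProduct k m m

-- Defined for every integer c; the exponents c - 1 and 2c - 3 may be negative.
ā : ℤ → Series
ā c = (f 4 ^ℤ (c - + 1)) ⊘ ((f 1 ^ℤ + 2) ⊛ (f 2 ^ℤ (+ 2 * c - + 3)))

inverse-correct : ∀ a → a 0 ≡ 1ℤ → ∀ n → (a ⊛ inverse a) n ≡ 𝟙 n
inverse-correct a a₀≡1 zero    = cong (λ x → x * 1ℤ + 0ℤ) a₀≡1
inverse-correct a a₀≡1 (suc n) = begin
  a 0 * - s + sum (λ (j : Fin (suc n)) → a (suc (toℕ j)) * inverse a (n ∸ toℕ j))
    ≡⟨ cong₂ _+_ (trans (cong (_* - s) a₀≡1) (*-identityˡ (- s)))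
         (sum-cong-≗ {suc n} λ j → cong (a (suc (toℕ j)) *_) (sym (lookup-inverse n j))) ⟩
  - s + s
    ≡⟨ +-inverseˡ s ⟩
  0ℤ ∎
  where
  open ≡-Reasoning

  s : ℤ
  s = sum (λ j → a (suc (toℕ j)) * lookup (inverseCoeffs a n) j)

  lookup-inverse : ∀ n (j : Fin (suc n)) →
                   lookup (inverseCoeffs a n) j ≡ inverse a (n ∸ toℕ j)
  lookup-inverse zero    zero    = refl
  lookup-inverse (suc n) zero    = refl
  lookup-inverse (suc n) (suc j) = lookup-inverse n j

f-limit : ∀ k .{{_ : NonZero k}} {m N} → m ℕ.≤ N → partialProduct k N m ≡ f k m
f-limit k {m} m≤N = go (ℕ.≤⇒≤′ m≤N)
  where
  open ≡-Reasoning

  factor : ℕ → Series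
  factor N = 𝟙 ⊖ q^ (k ℕ.* suc N)

  q^-off : ∀ d n → n ≢ d → q^ d n ≡ 0ℤ
  q^-off zero    zero    n≢d = contradiction refl n≢d
  q^-off zero    (suc n) n≢d = refl
  q^-off (suc d) zero    n≢d = refl
  q^-off (suc d) (suc n) n≢d = q^-off d n (λ n≡d → n≢d (cong suc n≡d))

  factor-0 : ∀ N → factor N 0 ≡ 1ℤ
  factor-0 N = cong (λ x → 1ℤ - x) (q^-off (k ℕ.* suc N) 0 λ p →
    ℕ.≢-nonZero⁻¹ (k ℕ.* suc N) {{ℕ.m*n≢0 k (suc N)}} (sym p))

  factor-suc : ∀ N {i} → i ℕ.< N → factor N (suc i) ≡ 0ℤ
  factor-suc N {i} i<N = cong (λ x → 0ℤ - x) (q^-off (k ℕ.* suc N) (suc i)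
    (ℕ.<⇒≢ (ℕ.<-≤-trans (ℕ.s≤s i<N) (ℕ.m≤n*m (suc N) k))))

  step : ∀ N → m ℕ.≤ N → partialProduct k (suc N) m ≡ partialProduct k N m
  step N m≤N = begin
    factor N 0 * P m + sum (λ (j : Fin m) → factor N (suc (toℕ j)) * P (m ∸ suc (toℕ j)))
      ≡⟨ cong₂ _+_ (trans (cong (_* P m) (factor-0 N)) (*-identityˡ (P m)))
           (trans (sum-cong-≗ {m} λ j →
                     cong (_* P (m ∸ suc (toℕ j)))
                          (factor-suc N (ℕ.<-≤-trans (toℕ<n j) m≤N)))
                  (sum-replicate-zero m)) ⟩
    P m + 0ℤ
      ≡⟨ +-identityʳ (P m) ⟩
    P m ∎
    where
    P = partialProduct k N

  go : ∀ {N} → m ℕ.≤′ N → partialProduct k N m ≡ f k m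
  go (ℕ.≤′-reflexive refl) = refl
  go (ℕ.≤′-step {N} m≤′N)  = trans (step N (ℕ.≤′⇒≤ m≤′N)) (go m≤′N)

{-# OPTIONS --safe #-}
-- Let φ = ∑ q^(s²) over s ∈ ℤ and u(q) = φ(-q²).  Gauss' identity gives u = f₂² / f₄, and with
-- f₁(-q) = f₂³ / (f₁ f₄) also φ = f₂⁵ / (f₁² f₄²), so that ∑ ā_c(n) qⁿ = φ / u^(c+1).
-- In the two families c + 1 = M - 2e with M = 2^(k-1) (2i + 1) and e ∈ {1, 0}.  Since u = 1 + 2S,
-- u^(8M) ≡ 1 mod 2^(k+3), so modulo 2^(k+3) the generating function is φ u^(7M+2e), with a
-- nonnegative exponent.  As u is even and the odd part of φ is 2 ∑ q^(s²) over odd s > 0,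
-- supported on exponents ≡ 1 mod 8, it is enough that 2^(k+2) divides the coefficients of
-- u^(7M+2e) at exponents ≡ 6 mod 8.  Now S is supported on the residues 0 and 2 mod 8, and
-- following the residues under multiplication and squaring shows for k ≥ 2 that
-- u^(2^(k-1)) = 1 + 2^k (X₀ + X₂ + X₄ + 4 R) with Xᵣ supported on the residue r.  For k = 1,
-- odd powers of u are products of u and a power of u².
module Submission where

open import Defs
open import Algebra.Bundles using (CommutativeRing)
import Algebra.Solver.Ring
open import Algebra.Solver.Ring.AlmostCommutativeRing
  using (fromCommutativeRing; _-Raw-AlmostCommutative⟶_)
open import Data.Empty using (⊥-elim)
open import Data.Integer using (ℤ; +_; -[1+_]; 0ℤ; 1ℤ; -1ℤ; _+_; _-_; _*_; -_; _^_; _/_)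
open import Data.Integer.Base using (+-*-rawRing)
import Data.Integer.DivMod as ℤ
open import Data.Integer.Divisibility using (_∣_)
import Data.Integer.Divisibility.Signed as Signed
open Signed using (divides) renaming (_∣_ to _∣ₛ_)
import Data.Integer.Properties as ℤ
open import Data.Integer.Tactic.RingSolver using (solve-∀)
import Data.Maybe as Maybe
open import Data.Nat as ℕ using (ℕ; zero; suc; z≤n; s≤s; NonZero)
import Data.Nat.DivMod as ℕ
import Data.Nat.Divisibility as ℕ
import Data.Nat.Properties as ℕ
open import Data.Nat.Tactic.RingSolver using () renaming (solve-∀ to ℕ-solve-∀)
open import Data.Product using (_×_; _,_; ∃-syntax)
open import Data.Sum using (_⊎_; inj₁; inj₂)
open import Level using (0ℓ)
open import Relation.Binary.PropositionalEquality
  using (_≡_; refl; sym; trans; cong; cong₂; subst; module ≡-Reasoning)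
import Relation.Binary.Reasoning.Setoid
open import Relation.Nullary using (¬_; yes; no)
open import Relation.Nullary.Decidable using (dec⇒maybe)

-- Shanks' finite form of Gauss' identity

-- The finite identities are formal: they hold in any commutative ring, with `morphism` supplying
-- the integer coefficients. Power series enter only when limits are taken.
module ℤAlgebra {r ℓ} (R : CommutativeRing r ℓ)
  (morphism : +-*-rawRing -Raw-AlmostCommutative⟶ fromCommutativeRing R) where

  open CommutativeRing R public
    renaming (_+_ to _⊞_; _*_ to _⊠_; -_ to ⊟_; _-_ to _⊟_;
              refl to ≈-refl; sym to ≈-sym; trans to ≈-trans)
  open _-Raw-AlmostCommutative⟶_ morphism public renaming (⟦_⟧ to ι)
  module ≈-Reasoning = Relation.Binary.Reasoning.Setoid setoid
  open ≈-Reasoning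

  module Solver = Algebra.Solver.Ring +-*-rawRing (fromCommutativeRing R) morphism
    (λ y z → Maybe.map (λ y≡z → reflexive (cong ι y≡z)) (dec⇒maybe (y ℤ.≟ z)))
  open Solver public using (solve; _:=_; _:+_; _:*_; _:-_; :-_; con; _:^_; Polynomial)

  -- con 1ℤ denotes ι 1ℤ, whereas an empty power denotes 1# itself.
  :1 : ∀ {n} → Polynomial n
  :1 = con 1ℤ :^ 0

  ∏ : (ℕ → Carrier) → ℕ → Carrier
  ∏ x zero    = 1#
  ∏ x (suc n) = (1# ⊟ x (suc n)) ⊠ ∏ x n

  -- With P_n = ∏ (1 - x^j) / (1 + x^j) over 1 ≤ j ≤ n, Shanks' identity reads
  --   1 + 2 ∑ (-1)^s x^(s²) = P_n + 2 ∑ (-1)^s x^(s (n + 1)) P_n / (P_s (1 + x^s)),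
  -- both sums over 1 ≤ s ≤ n.  Multiplied by D n, the right side has no denominators and is
  -- Z n 0, where Z m d is the part with s ≤ m for n = m + d.  The difference between Z m (d + 1)
  -- and (1 + x^(n+1)) Z m d telescopes to -2 β m d.
  module Shanks (x : ℕ → Carrier) (x-+ : ∀ a b → x (a ℕ.+ b) ≈ x a ⊠ x b) where

    ε : ℕ → Carrier
    ε zero    = 1#
    ε (suc n) = ⊟ ε n

    N : ℕ → ℕ → Carrier
    N m = ∏ λ j → x (m ℕ.+ j)

    D : ℕ → Carrier
    D zero    = 1#
    D (suc n) = (1# ⊞ x (suc n)) ⊠ D n

    S : ℕ → Carrier
    S zero    = 0#
    S (suc n) = S n ⊞ ε (suc n) ⊠ x (suc n ℕ.* suc n)

    T : ℕ → Carrier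
    T n = 1# ⊞ ι (+ 2) ⊠ S n

    -- The summand s = m + 1 for n = m + 1 + d, cleared of denominators: D_n P_n / (P_s (1 + x^s))
    -- is the product of 1 - x^j over s < j ≤ n times the product of 1 + x^j over j < s.
    τ : ℕ → ℕ → Carrier
    τ m d = ε (suc m) ⊠ x (suc m ℕ.* suc (suc m ℕ.+ d)) ⊠ (N (suc m) d ⊠ D m)

    Z : ℕ → ℕ → Carrier
    Z zero    d = N 0 d
    Z (suc m) d = Z m (suc d) ⊞ ι (+ 2) ⊠ τ m d

    β : ℕ → ℕ → Carrier
    β m d = ε m ⊠ x (suc m ℕ.* suc (m ℕ.+ d)) ⊠ (N m d ⊠ D m)

    x-cong : ∀ {a b} → a ≡ b → x a ≈ x b
    x-cong a≡b = reflexive (cong x a≡b)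

    N-front : ∀ m d → N m (suc d) ≈ (1# ⊟ x (suc m)) ⊠ N (suc m) d
    N-front m zero    = *-congʳ (+-congˡ (-‿cong (x-cong (ℕ.+-comm m 1))))
    N-front m (suc d) = begin
      (1# ⊟ x (m ℕ.+ suc (suc d))) ⊠ N m (suc d)
        ≈⟨ *-cong (+-congˡ (-‿cong (x-cong (ℕ.+-suc m (suc d))))) (N-front m d) ⟩
      (1# ⊟ x (suc m ℕ.+ suc d)) ⊠ ((1# ⊟ x (suc m)) ⊠ N (suc m) d)
        ≈⟨ solve 3 (λ a b c → a :* (b :* c) := b :* (a :* c)) ≈-refl _ _ _ ⟩
      (1# ⊟ x (suc m)) ⊠ N (suc m) (suc d) ∎

    module _ (m d : ℕ) where
      private
        s n : ℕ
        s = suc m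
        n = suc (s ℕ.+ d)

        X Y P : Carrier
        X = x n
        Y = x s
        P = x (s ℕ.* n)

        τ′ : τ m (suc d) ≈ (⊟ ε m) ⊠ (Y ⊠ P) ⊠ ((1# ⊟ X) ⊠ N s d ⊠ D m)
        τ′ = *-cong (*-congˡ (≈-trans
          (x-cong (trans (cong (λ j → s ℕ.* suc (suc j)) (ℕ.+-suc m d)) (ℕ.*-suc s n)))
          (x-+ s (s ℕ.* n))))
          (*-congʳ (*-congʳ (+-congˡ (-‿cong (x-cong (ℕ.+-suc s d))))))

        β′ : β m (suc d) ≈ ε m ⊠ P ⊠ ((1# ⊟ Y) ⊠ N s d ⊠ D m)
        β′ = *-cong (*-congˡ (x-cong (cong (λ j → s ℕ.* suc j) (ℕ.+-suc m d))))
                    (*-congʳ (N-front m d))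

        β″ : β s d ≈ (⊟ ε m) ⊠ (X ⊠ P) ⊠ (N s d ⊠ ((1# ⊞ Y) ⊠ D m))
        β″ = *-congʳ (*-congˡ (x-+ n (s ℕ.* n)))

      -- Taking out the common factor `ε m`, `P`, `N s d`, `D m` leaves the polynomial identity -Y
      -- (1 - X) - X (1 + Y) - (1 - Y) = -(1 + X).
      τ-telescopes : τ m (suc d) ⊞ (β s d ⊟ β m (suc d)) ≈ (1# ⊞ X) ⊠ τ m d
      τ-telescopes = begin
        τ m (suc d) ⊞ (β s d ⊟ β m (suc d))
          ≈⟨ +-cong τ′ (+-cong β″ (-‿cong β′)) ⟩
        _ ≈⟨ solve 6 (λ e X Y P N D →
               ((:- e) :* (Y :* P) :* ((:1 :- X) :* N :* D))
               :+ ((:- e) :* (X :* P) :* (N :* ((:1 :+ Y) :* D))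
                  :- e :* P :* ((:1 :- Y) :* N :* D))
               := (:1 :+ X) :* ((:- e) :* P :* (N :* D)))
             ≈-refl (ε m) X Y P (N s d) (D m) ⟩
        (1# ⊞ X) ⊠ τ m d ∎

    Z-step : ∀ m d → Z m (suc d) ≈ (1# ⊞ x (suc (m ℕ.+ d))) ⊠ Z m d ⊟ ι (+ 2) ⊠ β m d
    Z-step zero d = begin
      (1# ⊟ x (suc d)) ⊠ N 0 d
        ≈⟨ solve 2 (λ X N → (:1 :- X) :* N
             := (:1 :+ X) :* N :- con (+ 2) :* (:1 :* X :* (N :* :1))) ≈-refl _ _ ⟩
      (1# ⊞ x (suc d)) ⊠ N 0 d ⊟ ι (+ 2) ⊠ (1# ⊠ x (suc d) ⊠ (N 0 d ⊠ 1#))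
        ≈⟨ +-congˡ (-‿cong (*-congˡ (*-congʳ (*-congˡ (x-cong (sym (ℕ.*-identityˡ (suc d)))))))) ⟩
      (1# ⊞ x (suc d)) ⊠ Z 0 d ⊟ ι (+ 2) ⊠ β 0 d ∎
    Z-step (suc m) d = begin
      Z m (suc (suc d)) ⊞ ι (+ 2) ⊠ τ m (suc d)
        ≈⟨ +-congʳ (Z-step m (suc d)) ⟩
      (1# ⊞ x (suc (m ℕ.+ suc d))) ⊠ Z m (suc d) ⊟ ι (+ 2) ⊠ β m (suc d) ⊞ ι (+ 2) ⊠ τ m (suc d)
        ≈⟨ +-congʳ (+-congʳ (*-congʳ (+-congˡ (x-cong (cong suc (ℕ.+-suc m d)))))) ⟩
      (1# ⊞ X) ⊠ Z m (suc d) ⊟ ι (+ 2) ⊠ β m (suc d) ⊞ ι (+ 2) ⊠ τ m (suc d)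
        ≈⟨ solve 5 (λ U z b b′ t → U :* z :- con (+ 2) :* b :+ con (+ 2) :* t
             := U :* z :+ con (+ 2) :* (t :+ (b′ :- b)) :- con (+ 2) :* b′)
             ≈-refl _ _ _ (β (suc m) d) _ ⟩
      (1# ⊞ X) ⊠ Z m (suc d) ⊞ ι (+ 2) ⊠ (τ m (suc d) ⊞ (β (suc m) d ⊟ β m (suc d)))
        ⊟ ι (+ 2) ⊠ β (suc m) d
        ≈⟨ +-congʳ (+-congˡ (*-congˡ (τ-telescopes m d))) ⟩
      (1# ⊞ X) ⊠ Z m (suc d) ⊞ ι (+ 2) ⊠ ((1# ⊞ X) ⊠ τ m d) ⊟ ι (+ 2) ⊠ β (suc m) d
        ≈⟨ solve 4 (λ U z t b → U :* z :+ con (+ 2) :* (U :* t) :- b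
             := U :* (z :+ con (+ 2) :* t) :- b) ≈-refl _ _ _ _ ⟩
      (1# ⊞ X) ⊠ Z (suc m) d ⊟ ι (+ 2) ⊠ β (suc m) d ∎
      where
      X = x (suc (suc m ℕ.+ d))

    -- Induction on n. The new term of `T (suc n)`, multiplied by `(1# ⊞ X) ⊠ D n`, splits along 1 +
    -- X into -2 `β n 0` and 2 `τ n 0`; the first is the correction in `Z-step`, the second the new
    -- summand of `Z`.
    D-T≈Z : ∀ n → D n ⊠ T n ≈ Z n 0
    D-T≈Z zero    = ≈-trans (*-identityˡ _) (≈-trans (+-congˡ (zeroʳ _)) (+-identityʳ _))
    D-T≈Z (suc n) = begin
      (1# ⊞ X) ⊠ D n ⊠ (1# ⊞ ι (+ 2) ⊠ (S n ⊞ (⊟ ε n) ⊠ Y))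
        ≈⟨ solve 5 (λ X D S e Y → (:1 :+ X) :* D :* (:1 :+ con (+ 2) :* (S :+ (:- e) :* Y))
             := (:1 :+ X) :* (D :* (:1 :+ con (+ 2) :* S))
                :- con (+ 2) :* (e :* Y :* (:1 :* D))
                :+ con (+ 2) :* ((:- e) :* (X :* Y) :* (:1 :* D)))
             ≈-refl X (D n) (S n) (ε n) Y ⟩
      (1# ⊞ X) ⊠ (D n ⊠ T n) ⊟ ι (+ 2) ⊠ (ε n ⊠ Y ⊠ (1# ⊠ D n))
        ⊞ ι (+ 2) ⊠ ((⊟ ε n) ⊠ (X ⊠ Y) ⊠ (1# ⊠ D n))
        ≈⟨ +-cong (+-cong (*-cong (+-congˡ X′) (D-T≈Z n)) (-‿cong (*-congˡ (*-congʳ (*-congˡ Y′)))))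
                  (*-congˡ (*-congʳ (*-congˡ XY′))) ⟩
      (1# ⊞ x (suc (n ℕ.+ 0))) ⊠ Z n 0 ⊟ ι (+ 2) ⊠ β n 0 ⊞ ι (+ 2) ⊠ τ n 0
        ≈⟨ +-congʳ (Z-step n 0) ⟨
      Z (suc n) 0 ∎
      where
      X = x (suc n)
      Y = x (suc n ℕ.* suc n)
      X′ : X ≈ x (suc (n ℕ.+ 0))
      X′ = x-cong (cong suc (sym (ℕ.+-identityʳ n)))
      Y′ : Y ≈ x (suc n ℕ.* suc (n ℕ.+ 0))
      Y′ = x-cong (cong (λ j → suc n ℕ.* suc j) (sym (ℕ.+-identityʳ n)))
      XY′ : X ⊠ Y ≈ x (suc n ℕ.* suc (suc n ℕ.+ 0))
      XY′ = ≈-trans (≈-sym (x-+ (suc n) (suc n ℕ.* suc n)))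
        (x-cong (trans (sym (ℕ.*-suc (suc n) (suc n)))
        (cong (λ j → suc n ℕ.* suc j) (sym (ℕ.+-identityʳ (suc n))))))

    -- Every summand with s ≥ 1 contains x^(s (n + 1)) for n = m + d, hence the factor x^(n + 1).
    -- This is the error term that disappears in the limit.
    Z-tail : ∀ m d → ∃[ E ] Z m d ≈ N 0 (m ℕ.+ d) ⊞ x (suc (m ℕ.+ d)) ⊠ E
    Z-tail zero    d = ι 0ℤ , solve 2 (λ N X → N := N :+ X :* con 0ℤ) ≈-refl (N 0 d) (x (suc d))
    Z-tail (suc m) d with E , Z≈ ← Z-tail m (suc d) =
      -- The new summand has exponent (m + 1) n = n + m n, so `x (m ℕ.* n)` remains after `X` is
      -- taken out.
      E ⊞ ι (+ 2) ⊠ (ε (suc m) ⊠ x (m ℕ.* n) ⊠ K) , (begin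
      Z m (suc d) ⊞ ι (+ 2) ⊠ τ m d
        ≈⟨ +-cong Z≈ (*-congˡ (*-congʳ (*-congˡ (x-+ n (m ℕ.* n))))) ⟩
      N 0 (m ℕ.+ suc d) ⊞ x (suc (m ℕ.+ suc d)) ⊠ E ⊞ ι (+ 2) ⊠ (ε (suc m) ⊠ (X ⊠ x (m ℕ.* n)) ⊠ K)
        ≈⟨ +-congʳ (reflexive (cong (λ j → N 0 j ⊞ x (suc j) ⊠ E) (ℕ.+-suc m d))) ⟩
      N 0 (suc m ℕ.+ d) ⊞ X ⊠ E ⊞ ι (+ 2) ⊠ (ε (suc m) ⊠ (X ⊠ x (m ℕ.* n)) ⊠ K)
        ≈⟨ solve 6 (λ N X E e Y K → N :+ X :* E :+ con (+ 2) :* (e :* (X :* Y) :* K)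
             := N :+ X :* (E :+ con (+ 2) :* (e :* Y :* K))) ≈-refl _ _ _ _ _ _ ⟩
      N 0 (suc m ℕ.+ d) ⊞ X ⊠ (E ⊞ ι (+ 2) ⊠ (ε (suc m) ⊠ x (m ℕ.* n) ⊠ K)) ∎)
      where
      n = suc (suc m ℕ.+ d)
      X = x n
      K = N (suc m) d ⊠ D m

    D-∏ : (y : ℕ → Carrier) → (∀ n → x n ⊠ x n ≈ y n) → ∀ n → D n ⊠ ∏ x n ≈ ∏ y n
    D-∏ y x²≈y zero    = *-identityˡ 1#
    D-∏ y x²≈y (suc n) = begin
      (1# ⊞ X) ⊠ D n ⊠ ((1# ⊟ X) ⊠ ∏ x n)
        ≈⟨ solve 3 (λ X D N → (:1 :+ X) :* D :* ((:1 :- X) :* N) := (:1 :- X :* X) :* (D :* N))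
             ≈-refl _ _ _ ⟩
      (1# ⊟ X ⊠ X) ⊠ (D n ⊠ ∏ x n)
        ≈⟨ *-cong (+-congˡ (-‿cong (x²≈y (suc n)))) (D-∏ y x²≈y n) ⟩
      ∏ y (suc n) ∎
      where
      X = x (suc n)

    D-T≈N : ∀ n → ∃[ E ] D n ⊠ T n ≈ ∏ x n ⊞ x (suc n) ⊠ E
    D-T≈N n with E , Z≈ ← Z-tail n 0 = E , (begin
      D n ⊠ T n                                        ≈⟨ D-T≈Z n ⟩
      Z n 0                                            ≈⟨ Z≈ ⟩
      N 0 (n ℕ.+ 0) ⊞ x (suc (n ℕ.+ 0)) ⊠ E
        ≈⟨ reflexive (cong (λ j → N 0 j ⊞ x (suc j) ⊠ E) (ℕ.+-identityʳ n)) ⟩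
      ∏ x n ⊞ x (suc n) ⊠ E                            ∎)

    -- Gauss' identity before the limit: multiplying by `∏ x n` turns `D n` into `∏ y n`, because (1
    -- + x^j)(1 - x^j) = 1 - x^(2j).
    shanks : (y : ℕ → Carrier) → (∀ n → x n ⊠ x n ≈ y n) → ∀ n →
             ∃[ E ] T n ⊠ ∏ y n ≈ ∏ x n ⊠ ∏ x n ⊞ x (suc n) ⊠ E
    shanks y x²≈y n with E , DT≈ ← D-T≈N n = E ⊠ ∏ x n , (begin
      T n ⊠ ∏ y n                        ≈⟨ *-congˡ (D-∏ y x²≈y n) ⟨
      T n ⊠ (D n ⊠ ∏ x n)
        ≈⟨ solve 3 (λ T D P → T :* (D :* P) := D :* T :* P) ≈-refl _ _ _ ⟩
      D n ⊠ T n ⊠ ∏ x n                  ≈⟨ *-congʳ DT≈ ⟩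
      (∏ x n ⊞ x (suc n) ⊠ E) ⊠ ∏ x n
        ≈⟨ solve 3 (λ P X E → (P :+ X :* E) :* P := P :* P :+ X :* (E :* P)) ≈-refl _ _ _ ⟩
      ∏ x n ⊠ ∏ x n ⊞ x (suc n) ⊠ (E ⊠ ∏ x n) ∎)

  -- Formal identities between products.

  -- The truncated form of f₁(-q) f₁ f₄ = f₂³, with `x`, `e`, `e₂`, `e₄` standing for the powers of
  -- -q, q, q², q⁴. A step adds two factors to each long product: at the odd index `a` they combine
  -- to 1 - e₂(a), at the even index `b` they give the square of 1 - e₂(n + 1), and the new factor
  -- of `∏ e₄` is 1 - e₂(b).
  ∏-conjugate : (x e e₂ e₄ : ℕ → Carrier) →
    (∀ n → x (n ℕ.* 2) ≈ e (n ℕ.* 2)) → (∀ n → x (suc (n ℕ.* 2)) ≈ ⊟ e (suc (n ℕ.* 2))) →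
    (∀ n → e n ⊠ e n ≈ e₂ n) → (∀ n → e (n ℕ.* 2) ≈ e₂ n) → (∀ n → e₂ (n ℕ.* 2) ≈ e₄ n) →
    ∀ n → ∏ x (n ℕ.* 2) ⊠ ∏ e (n ℕ.* 2) ⊠ ∏ e₄ n ≈ ∏ e₂ n ⊠ ∏ e₂ n ⊠ ∏ e₂ (n ℕ.* 2)
  ∏-conjugate x e e₂ e₄ x-even x-odd e² e-even e₂-even = go
    where
    go : ∀ n → ∏ x (n ℕ.* 2) ⊠ ∏ e (n ℕ.* 2) ⊠ ∏ e₄ n ≈ ∏ e₂ n ⊠ ∏ e₂ n ⊠ ∏ e₂ (n ℕ.* 2)
    go zero    = ≈-refl
    go (suc n) = begin
      (1# ⊟ x b) ⊠ ((1# ⊟ x a) ⊠ P) ⊠ ((1# ⊟ e b) ⊠ ((1# ⊟ e a) ⊠ Q)) ⊠ ((1# ⊟ e₄ (suc n)) ⊠ V)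
        ≈⟨ *-cong (*-cong
             (*-cong (1⊟-cong (≈-trans (x-even (suc n)) (e-even (suc n))))
               (*-congʳ (1⊟-cong (x-odd n))))
             (*-congʳ (1⊟-cong (e-even (suc n)))))
             (*-congʳ (1⊟-cong (≈-sym (e₂-even (suc n))))) ⟩
      (1# ⊟ e₂ (suc n)) ⊠ ((1# ⊟ ⊟ e a) ⊠ P) ⊠ ((1# ⊟ e₂ (suc n)) ⊠ ((1# ⊟ e a) ⊠ Q)) ⊠ ((1# ⊟ e₂ b) ⊠ V)
        ≈⟨ solve 6 (λ X Y W P Q R →
             (:1 :- X) :* ((:1 :- :- Y) :* P) :* ((:1 :- X) :* ((:1 :- Y) :* Q)) :* ((:1 :- W) :* R)
             := (:1 :- X) :* (:1 :- X) :* ((:1 :- W) :* (:1 :- Y :* Y)) :* (P :* Q :* R))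
             ≈-refl _ _ _ _ _ _ ⟩
      (1# ⊟ e₂ (suc n)) ⊠ (1# ⊟ e₂ (suc n)) ⊠ ((1# ⊟ e₂ b) ⊠ (1# ⊟ e a ⊠ e a)) ⊠ (P ⊠ Q ⊠ V)
        ≈⟨ *-cong (*-congˡ (*-congˡ (1⊟-cong (e² a)))) (go n) ⟩
      (1# ⊟ e₂ (suc n)) ⊠ (1# ⊟ e₂ (suc n)) ⊠ ((1# ⊟ e₂ b) ⊠ (1# ⊟ e₂ a))
        ⊠ (∏ e₂ n ⊠ ∏ e₂ n ⊠ ∏ e₂ (n ℕ.* 2))
        ≈⟨ solve 5 (λ X W Y A B →
             X :* X :* (W :* Y) :* (A :* A :* B) := X :* A :* (X :* A) :* (W :* (Y :* B)))
             ≈-refl _ _ _ _ _ ⟩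
      ∏ e₂ (suc n) ⊠ ∏ e₂ (suc n) ⊠ ∏ e₂ (suc n ℕ.* 2) ∎
      where
      a = suc (n ℕ.* 2)
      b = suc n ℕ.* 2
      P = ∏ x (n ℕ.* 2)
      Q = ∏ e (n ℕ.* 2)
      V = ∏ e₄ n
      1⊟-cong : ∀ {y z} → y ≈ z → 1# ⊟ y ≈ 1# ⊟ z
      1⊟-cong y≈z = +-congˡ (-‿cong y≈z)

  -- The pattern of `ā-theta`, without division: `A`, `B`, `C` are ā_c, f₂^(2c-3), f₄^(c-1), the
  -- letters `a`, `b`, `d`, `p` are f₁, f₂, f₄, φ, and `w`, `wₑ` are powers of u. The two sides
  -- share a factor that is cancelled at the point of use.
  eliminate-products : ∀ A B C a b d p bₘ dₘ bₑ dₑ w wₑ →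
    A ⊠ (a ⊠ (a ⊠ 1#) ⊠ B) ≈ C →
    B ⊠ (b ⊠ (b ⊠ (b ⊠ (b ⊠ (b ⊠ 1#)))) ⊠ bₑ) ≈ bₘ →
    C ⊠ (d ⊠ (d ⊠ 1#) ⊠ dₑ) ≈ dₘ →
    bₘ ≈ w ⊠ dₘ → bₑ ≈ wₑ ⊠ dₑ →
    p ⊠ (a ⊠ a ⊠ (d ⊠ d)) ≈ b ⊠ b ⊠ b ⊠ b ⊠ b →
    A ⊠ w ⊠ (a ⊠ a ⊠ (d ⊠ d) ⊠ (dₑ ⊠ dₘ)) ≈ p ⊠ wₑ ⊠ (a ⊠ a ⊠ (d ⊠ d) ⊠ (dₑ ⊠ dₘ))
  eliminate-products A B C a b d p bₘ dₘ bₑ dₑ w wₑ AaB≈C Bb≈ Cd≈ bₘ≈ bₑ≈ p≈ = begin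
    A ⊠ w ⊠ (a ⊠ a ⊠ (d ⊠ d) ⊠ (dₑ ⊠ dₘ))
      ≈⟨ solve 6 (λ A w a d e m → A :* w :* (a :* a :* (d :* d) :* (e :* m))
           := A :* (w :* m) :* (a :* a :* (d :* d) :* e)) ≈-refl A w a d dₑ dₘ ⟩
    A ⊠ (w ⊠ dₘ) ⊠ (a ⊠ a ⊠ (d ⊠ d) ⊠ dₑ)
      ≈⟨ *-congʳ (*-congˡ (≈-trans (≈-sym bₘ≈) (≈-sym Bb≈))) ⟩
    A ⊠ (B ⊠ (b ⊠ (b ⊠ (b ⊠ (b ⊠ (b ⊠ 1#)))) ⊠ bₑ)) ⊠ (a ⊠ a ⊠ (d ⊠ d) ⊠ dₑ)
      ≈⟨ solve 7 (λ A B b f a d e →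
           A :* (B :* (b :* (b :* (b :* (b :* (b :* :1)))) :* f)) :* (a :* a :* (d :* d) :* e)
           := A :* (a :* (a :* :1) :* B) :* (d :* (d :* :1) :* e) :* (b :* b :* b :* b :* b :* f))
           ≈-refl A B b bₑ a d dₑ ⟩
    A ⊠ (a ⊠ (a ⊠ 1#) ⊠ B) ⊠ (d ⊠ (d ⊠ 1#) ⊠ dₑ) ⊠ (b ⊠ b ⊠ b ⊠ b ⊠ b ⊠ bₑ)
      ≈⟨ *-cong (≈-trans (*-congʳ AaB≈C) Cd≈) (*-cong (≈-sym p≈) bₑ≈) ⟩
    dₘ ⊠ (p ⊠ (a ⊠ a ⊠ (d ⊠ d)) ⊠ (wₑ ⊠ dₑ))
      ≈⟨ solve 6 (λ m p a d w e → m :* (p :* (a :* a :* (d :* d)) :* (w :* e))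
           := p :* w :* (a :* a :* (d :* d) :* (e :* m))) ≈-refl dₘ p a d wₑ dₑ ⟩
    p ⊠ wₑ ⊠ (a ⊠ a ⊠ (d ⊠ d) ⊠ (dₑ ⊠ dₘ)) ∎

  -- Here `c` is f₁(-q). Squaring the second hypothesis makes it appear only as `c ⊠ c`, which the
  -- first replaces by φ f₂. The extra factor `b` is cancelled later.
  eliminate-conjugate : ∀ p a b c d → p ⊠ b ≈ c ⊠ c → c ⊠ a ⊠ d ≈ b ⊠ b ⊠ b →
    p ⊠ (a ⊠ a ⊠ (d ⊠ d)) ⊠ b ≈ b ⊠ b ⊠ b ⊠ b ⊠ b ⊠ b
  eliminate-conjugate p a b c d pb≈cc cad≈bbb = begin
    p ⊠ (a ⊠ a ⊠ (d ⊠ d)) ⊠ b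
      ≈⟨ solve 4 (λ p a b d → p :* (a :* a :* (d :* d)) :* b := p :* b :* (a :* a :* (d :* d)))
           ≈-refl p a b d ⟩
    p ⊠ b ⊠ (a ⊠ a ⊠ (d ⊠ d))
      ≈⟨ *-congʳ pb≈cc ⟩
    c ⊠ c ⊠ (a ⊠ a ⊠ (d ⊠ d))
      ≈⟨ solve 3 (λ c a d → c :* c :* (a :* a :* (d :* d)) := c :* a :* d :* (c :* a :* d))
           ≈-refl c a d ⟩
    c ⊠ a ⊠ d ⊠ (c ⊠ a ⊠ d)
      ≈⟨ *-cong cad≈bbb cad≈bbb ⟩
    b ⊠ b ⊠ b ⊠ (b ⊠ b ⊠ b)
      ≈⟨ solve 1 (λ b → b :* b :* b :* (b :* b :* b) := b :* b :* b :* b :* b :* b) ≈-refl b ⟩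
    b ⊠ b ⊠ b ⊠ b ⊠ b ⊠ b ∎

-- The ring of power series

-- A record, so that both series can be inferred from the type of an equation.
infix 4 _≈_
record _≈_ (a b : Series) : Set where
  constructor coeffwise
  field coeff : ∀ n → a n ≡ b n
open _≈_

infixl 6 _⊕_
infix 8 ⊝_

_⊕_ : Series → Series → Series
(a ⊕ b) n = a n + b n

⊝_ : Series → Series
(⊝ a) n = - a n

const : ℤ → Series
const z zero    = z
const z (suc n) = 0ℤ

tail : Series → Series
tail a n = a (suc n)

infixr 7 _⊙_
_⊙_ : ℤ → Series → Series
(z ⊙ a) n = z * a n

-- The hypotheses are bounded by n so that the lemma also serves approximants, which agree with
-- their limit only up to some exponent.
⊛-cong : ∀ {a a′ b b′} n → (∀ m → m ℕ.≤ n → a m ≡ a′ m) → (∀ m → m ℕ.≤ n → b m ≡ b′ m) →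
         (a ⊛ b) n ≡ (a′ ⊛ b′) n
⊛-cong zero    p q = cong (_+ 0ℤ) (cong₂ _*_ (p 0 z≤n) (q 0 z≤n))
⊛-cong (suc n) p q = cong₂ _+_ (cong₂ _*_ (p 0 z≤n) (q (suc n) ℕ.≤-refl))
  (⊛-cong n (λ m m≤n → p (suc m) (s≤s m≤n)) (λ m m≤n → q m (ℕ.m≤n⇒m≤1+n m≤n)))

-- By definition a product sheds its first term `a 0 * b (suc n)`. Shedding the last one instead is
-- the mirror image from which commutativity follows.
⊛-suc : ∀ a b n → (a ⊛ b) (suc n) ≡ (a ⊛ tail b) n + a (suc n) * b 0
⊛-suc a b zero    = lemma (a 0 * b 1) (a 1 * b 0)
  where
  lemma : ∀ x y → x + (y + 0ℤ) ≡ (x + 0ℤ) + y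
  lemma = solve-∀
⊛-suc a b (suc n) = begin
  a 0 * b (suc (suc n)) + (tail a ⊛ b) (suc n)
    ≡⟨ cong (λ t → a 0 * b (suc (suc n)) + t) (⊛-suc (tail a) b n) ⟩
  a 0 * b (suc (suc n)) + ((tail a ⊛ tail b) n + a (suc (suc n)) * b 0)
    ≡⟨ ℤ.+-assoc (a 0 * b (suc (suc n))) _ _ ⟨
  (a ⊛ tail b) (suc n) + a (suc (suc n)) * b 0 ∎
  where open ≡-Reasoning

⊛-comm : ∀ a b n → (a ⊛ b) n ≡ (b ⊛ a) n
⊛-comm a b zero    = cong (_+ 0ℤ) (ℤ.*-comm (a 0) (b 0))
⊛-comm a b (suc n) = begin
  a 0 * b (suc n) + (tail a ⊛ b) n  ≡⟨ cong₂ _+_ (ℤ.*-comm (a 0) _) (⊛-comm (tail a) b n) ⟩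
  b (suc n) * a 0 + (b ⊛ tail a) n  ≡⟨ ℤ.+-comm (b (suc n) * a 0) _ ⟩
  (b ⊛ tail a) n + b (suc n) * a 0  ≡⟨ ⊛-suc b a n ⟨
  (b ⊛ a) (suc n) ∎
  where open ≡-Reasoning

⊛-distribʳ : ∀ c a b n → ((a ⊕ b) ⊛ c) n ≡ (a ⊛ c) n + (b ⊛ c) n
⊛-distribʳ c a b zero    = lemma (a 0) (b 0) (c 0)
  where
  lemma : ∀ x y z → (x + y) * z + 0ℤ ≡ (x * z + 0ℤ) + (y * z + 0ℤ)
  lemma = solve-∀
⊛-distribʳ c a b (suc n) = begin
  (a 0 + b 0) * c (suc n) + ((tail a ⊕ tail b) ⊛ c) n
    ≡⟨ cong (λ t → (a 0 + b 0) * c (suc n) + t) (⊛-distribʳ c (tail a) (tail b) n) ⟩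
  (a 0 + b 0) * c (suc n) + ((tail a ⊛ c) n + (tail b ⊛ c) n)
    ≡⟨ lemma (a 0) (b 0) (c (suc n)) _ _ ⟩
  (a ⊛ c) (suc n) + (b ⊛ c) (suc n) ∎
  where
  open ≡-Reasoning
  lemma : ∀ x y z s t → (x + y) * z + (s + t) ≡ (x * z + s) + (y * z + t)
  lemma = solve-∀

⊙-⊛-assoc : ∀ z a b n → ((z ⊙ a) ⊛ b) n ≡ z * (a ⊛ b) n
⊙-⊛-assoc z a b zero    = lemma z (a 0) (b 0)
  where
  lemma : ∀ z x y → (z * x) * y + 0ℤ ≡ z * (x * y + 0ℤ)
  lemma = solve-∀
⊙-⊛-assoc z a b (suc n) = begin
  (z * a 0) * b (suc n) + ((z ⊙ tail a) ⊛ b) n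
    ≡⟨ cong (λ t → (z * a 0) * b (suc n) + t) (⊙-⊛-assoc z (tail a) b n) ⟩
  (z * a 0) * b (suc n) + z * (tail a ⊛ b) n
    ≡⟨ lemma z (a 0) (b (suc n)) _ ⟩
  z * (a ⊛ b) (suc n) ∎
  where
  open ≡-Reasoning
  lemma : ∀ z x y s → (z * x) * y + z * s ≡ z * (x * y + s)
  lemma = solve-∀

-- Induction on n for all `a` at once: `tail (a ⊛ b)` unfolds to `(a 0 ⊙ tail b) ⊕ (tail a ⊛ b)`, so
-- linearity leads back to `tail a`.
⊛-assoc : ∀ a b c n → ((a ⊛ b) ⊛ c) n ≡ (a ⊛ (b ⊛ c)) n
⊛-assoc a b c zero    = lemma (a 0) (b 0) (c 0)
  where
  lemma : ∀ x y z → (x * y + 0ℤ) * z + 0ℤ ≡ x * (y * z + 0ℤ) + 0ℤ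
  lemma = solve-∀
⊛-assoc a b c (suc n) = begin
  (a 0 * b 0 + 0ℤ) * c (suc n) + (((a 0 ⊙ tail b) ⊕ (tail a ⊛ b)) ⊛ c) n
    ≡⟨ cong (λ t → (a 0 * b 0 + 0ℤ) * c (suc n) + t) (trans
         (⊛-distribʳ c (a 0 ⊙ tail b) (tail a ⊛ b) n)
         (cong₂ _+_ (⊙-⊛-assoc (a 0) (tail b) c n) (⊛-assoc (tail a) b c n))) ⟩
  (a 0 * b 0 + 0ℤ) * c (suc n) + (a 0 * (tail b ⊛ c) n + (tail a ⊛ (b ⊛ c)) n)
    ≡⟨ lemma (a 0) (b 0) (c (suc n)) _ _ ⟩
  (a ⊛ (b ⊛ c)) (suc n) ∎
  where
  open ≡-Reasoning
  lemma : ∀ x y z s t → (x * y + 0ℤ) * z + (x * s + t) ≡ x * (y * z + s) + t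
  lemma = solve-∀

𝟘 : Series
𝟘 _ = 0ℤ

𝟘-⊛ : ∀ a n → (𝟘 ⊛ a) n ≡ 0ℤ
𝟘-⊛ a zero    = refl
𝟘-⊛ a (suc n) = trans (ℤ.+-identityˡ _) (𝟘-⊛ a n)

const-⊛ : ∀ z a n → (const z ⊛ a) n ≡ z * a n
const-⊛ z a zero    = ℤ.+-identityʳ _
const-⊛ z a (suc n) = trans (cong (λ t → z * a (suc n) + t) (𝟘-⊛ a n)) (ℤ.+-identityʳ _)

𝟙-⊛ : ∀ a n → (𝟙 ⊛ a) n ≡ a n
𝟙-⊛ a zero    = trans (ℤ.+-identityʳ _) (ℤ.*-identityˡ _)
𝟙-⊛ a (suc n) = trans (cong (λ t → 1ℤ * a (suc n) + t) (𝟘-⊛ a n))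
                      (trans (ℤ.+-identityʳ _) (ℤ.*-identityˡ _))

seriesRing : CommutativeRing 0ℓ 0ℓ
seriesRing = record
  { Carrier = Series ; _≈_ = _≈_ ; _+_ = _⊕_ ; _*_ = _⊛_ ; -_ = ⊝_ ; 0# = 𝟘 ; 1# = 𝟙
  ; isCommutativeRing = record
    { isRing = record
      { +-isAbelianGroup = record
        { isGroup = record
          { isMonoid = record
            { isSemigroup = record
              { isMagma = record
                { isEquivalence = record
                  { refl  = coeffwise λ n → refl
                  ; sym   = λ p → coeffwise λ n → sym (coeff p n)
                  ; trans = λ p q → coeffwise λ n → trans (coeff p n) (coeff q n) }
                ; ∙-cong = λ p q → coeffwise λ n → cong₂ _+_ (coeff p n) (coeff q n) }
              ; assoc = λ a b c → coeffwise λ n → ℤ.+-assoc (a n) (b n) (c n) }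
            ; identity = (λ a → coeffwise λ n → ℤ.+-identityˡ (a n))
                       , (λ a → coeffwise λ n → ℤ.+-identityʳ (a n)) }
          ; inverse = (λ a → coeffwise λ n → ℤ.+-inverseˡ (a n))
                    , (λ a → coeffwise λ n → ℤ.+-inverseʳ (a n))
          ; ⁻¹-cong = λ p → coeffwise λ n → cong -_ (coeff p n) }
        ; comm = λ a b → coeffwise λ n → ℤ.+-comm (a n) (b n) }
      ; *-cong = λ p q → coeffwise λ n → ⊛-cong n (λ m _ → coeff p m) (λ m _ → coeff q m)
      ; *-assoc = λ a b c → coeffwise (⊛-assoc a b c)
      ; *-identity = (λ a → coeffwise (𝟙-⊛ a))
                   , (λ a → coeffwise λ n → trans (⊛-comm a 𝟙 n) (𝟙-⊛ a n))
      ; distrib = (λ a b c → coeffwise λ n → trans (⊛-comm a (b ⊕ c) n)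
                    (trans (⊛-distribʳ a b c n) (cong₂ _+_ (⊛-comm b a n) (⊛-comm c a n))))
                , (λ c a b → coeffwise (⊛-distribʳ c a b)) }
    ; *-comm = λ a b → coeffwise (⊛-comm a b) } }

const-morphism : +-*-rawRing -Raw-AlmostCommutative⟶ fromCommutativeRing seriesRing
const-morphism = record
  { ⟦_⟧    = const
  ; +-homo = λ y z → coeffwise λ { zero → refl ; (suc n) → refl }
  ; *-homo = λ y z → coeffwise λ { zero    → sym (ℤ.+-identityʳ (y * z))
                                 ; (suc n) → sym (trans (const-⊛ y (const z) (suc n)) (ℤ.*-zeroʳ y)) }
  ; -‿homo = λ z → coeffwise λ { zero → refl ; (suc n) → refl }
  ; 0-homo = coeffwise λ { zero → refl ; (suc n) → refl }
  ; 1-homo = coeffwise λ { zero → refl ; (suc n) → refl } }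

open ℤAlgebra seriesRing const-morphism hiding (_≈_)

-- Gauss' identity

Vanishes : ℕ → Series → Set
Vanishes k a = ∀ {n} → n ℕ.< k → a n ≡ 0ℤ

⊛-vanishes : ∀ {k a} b → Vanishes k a → Vanishes k (a ⊛ b)
⊛-vanishes {a = a} b a-van {n} n<k = trans
  (⊛-cong {a} {𝟘} {b} {b} n (λ m m≤n → a-van (ℕ.≤-<-trans m≤n n<k)) (λ _ _ → refl))
  (𝟘-⊛ b n)

infix 4 _⟶_
-- Coefficientwise convergence with a fixed rate: the N-th approximant is exact through q^N.
_⟶_ : (ℕ → Series) → Series → Set
F ⟶ L = ∀ {n N} → n ℕ.≤ N → F N n ≡ L n

diagonal : (ℕ → Series) → Series
diagonal F n = F n n

⟶-diagonal : ∀ {F} → (∀ {n N} → n ℕ.≤ N → F (suc N) n ≡ F N n) → F ⟶ diagonal F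
⟶-diagonal {F} stable n≤N = go (ℕ.≤⇒≤′ n≤N)
  where
  go : ∀ {n N} → n ℕ.≤′ N → F N n ≡ F n n
  go (ℕ.≤′-reflexive refl) = refl
  go (ℕ.≤′-step n≤′N)      = trans (stable (ℕ.≤′⇒≤ n≤′N)) (go n≤′N)

⟶-⊛ : ∀ {F G K L} → F ⟶ K → G ⟶ L → (λ N → F N ⊛ G N) ⟶ K ⊛ L
⟶-⊛ {F} {G} {K} {L} F⟶ G⟶ {n} {N} n≤N =
  ⊛-cong {F N} {K} {G N} {L} n (λ m m≤n → F⟶ (ℕ.≤-trans m≤n n≤N)) (λ m m≤n → G⟶ (ℕ.≤-trans m≤n n≤N))

⟶-subsequence : ∀ {F K} (h : ℕ → ℕ) → (∀ N → N ℕ.≤ h N) → F ⟶ K → (λ N → F (h N)) ⟶ K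
⟶-subsequence h N≤hN F⟶ n≤N = F⟶ (ℕ.≤-trans n≤N (N≤hN _))

-- With that rate, the n-th approximants already determine coefficient n, so comparing the diagonals
-- suffices.
⟶-unique : ∀ {F G K L} → F ⟶ K → G ⟶ L → (∀ n → F n n ≡ G n n) → K ≈ L
⟶-unique F⟶ G⟶ F≡G = coeffwise λ n →
  trans (sym (F⟶ (ℕ.≤-refl {n}))) (trans (F≡G n) (G⟶ ℕ.≤-refl))

∏-limit : ∀ x → (∀ n → Vanishes n (x n)) → ∏ x ⟶ diagonal (∏ x)
∏-limit x x-van = ⟶-diagonal λ {n} {N} n≤N → begin
  ((𝟙 ⊖ x (suc N)) ⊛ ∏ x N) n
    ≡⟨ coeff (solve 2 (λ X P → (:1 :- X) :* P := P :- X :* P) ≈-refl (x (suc N)) (∏ x N)) n ⟩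
  ∏ x N n - (x (suc N) ⊛ ∏ x N) n
    ≡⟨ cong (λ t → ∏ x N n - t) (⊛-vanishes (∏ x N) (x-van (suc N)) (s≤s n≤N)) ⟩
  ∏ x N n - 0ℤ
    ≡⟨ ℤ.+-identityʳ _ ⟩
  ∏ x N n ∎
  where open ≡-Reasoning

-- Passage to the limit in `Shanks` when `x a` is a multiple of the monomial q^(d a); since d ≥ 1,
-- its order grows at least like a.
module Gauss (d : ℕ) .{{_ : NonZero d}} (x : ℕ → Series)
  (x-+ : ∀ a b → x (a ℕ.+ b) ≈ x a ⊛ x b)
  (x-support : ∀ a n → x a n ≡ 0ℤ ⊎ n ≡ d ℕ.* a) where

  open Shanks x x-+

  x-vanishes : ∀ n → Vanishes n (x n)
  x-vanishes n {m} m<n with x-support n m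
  ... | inj₁ eq   = eq
  ... | inj₂ refl = ⊥-elim (ℕ.<⇒≱ m<n (ℕ.m≤n*m n d))

  S-term : ∀ s t n → (ε s ⊛ x t) n ≡ 0ℤ ⊎ n ≡ d ℕ.* t
  S-term zero    t n with x-support t n
  ... | inj₁ eq = inj₁ (trans (𝟙-⊛ (x t) n) eq)
  ... | inj₂ eq = inj₂ eq
  S-term (suc s) t n with S-term s t n
  ... | inj₁ eq = inj₁ (trans (coeff (solve 2 (λ e X → (:- e) :* X := :- (e :* X))
    ≈-refl (ε s) (x t)) n)
                              (cong -_ eq))
  ... | inj₂ eq = inj₂ eq

  S∞ Θ : Series
  S∞ = diagonal S
  Θ  = 𝟙 ⊕ const (+ 2) ⊛ S∞

  S-support : ∀ N n → S N n ≡ 0ℤ ⊎ (∃[ s ] n ≡ d ℕ.* (s ℕ.* s))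
  S-support zero    n = inj₁ refl
  S-support (suc N) n with S-support N n | S-term (suc N) (suc N ℕ.* suc N) n
  ... | inj₁ p | inj₁ q = inj₁ (cong₂ _+_ p q)
  ... | inj₂ p | _      = inj₂ p
  ... | inj₁ _ | inj₂ q = inj₂ (suc N , q)

  S⟶S∞ : S ⟶ S∞
  S⟶S∞ = ⟶-diagonal {S} λ {n} {N} n≤N → trans
    (cong (λ t → S N n + t) (trans
      (⊛-comm (ε (suc N)) (x (suc N ℕ.* suc N)) n)
      (⊛-vanishes (ε (suc N)) (x-vanishes (suc N ℕ.* suc N))
        (ℕ.≤-trans (s≤s n≤N) (ℕ.m≤m*n (suc N) (suc N))))))
    (ℤ.+-identityʳ _)

  T⟶Θ : T ⟶ Θ
  T⟶Θ {n} n≤N = cong (λ t → 𝟙 n + t) (⟶-⊛ {λ _ → const (+ 2)} (λ _ → refl) S⟶S∞ n≤N)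

  gauss : ∀ y → (∀ n → x n ⊛ x n ≈ y n) →
          Θ ⊛ diagonal (∏ y) ≈ diagonal (∏ x) ⊛ diagonal (∏ x)
  gauss y x²≈y = ⟶-unique
    (⟶-⊛ T⟶Θ (∏-limit y λ n {m} m<n →
      trans (sym (coeff (x²≈y n) m)) (⊛-vanishes (x n) (x-vanishes n) m<n)))
    (⟶-⊛ (∏-limit x x-vanishes) (∏-limit x x-vanishes))
    -- The error term of `shanks` at n is a multiple of `x (suc n)`, which has no coefficient at n.
    λ n → let E , T∏y≈ = shanks y x²≈y n in trans (coeff T∏y≈ n) (trans
      (cong (λ t → (∏ x n ⊛ ∏ x n) n + t) (⊛-vanishes E (x-vanishes (suc n)) (ℕ.n<1+n n)))
      (ℤ.+-identityʳ _))

-- Powers of q and of -q, and the series φ and u.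

q^-support : ∀ a n → q^ a n ≡ 0ℤ ⊎ n ≡ a
q^-support zero    zero    = inj₂ refl
q^-support zero    (suc n) = inj₁ refl
q^-support (suc a) zero    = inj₁ refl
q^-support (suc a) (suc n) with q^-support a n
... | inj₁ eq = inj₁ eq
... | inj₂ eq = inj₂ (cong suc eq)

q^-+ : ∀ a b → q^ (a ℕ.+ b) ≈ q^ a ⊛ q^ b
q^-+ a b = coeffwise (go a)
  where
  go : ∀ a n → q^ (a ℕ.+ b) n ≡ (q^ a ⊛ q^ b) n
  go zero    n       = sym (𝟙-⊛ (q^ b) n)
  go (suc a) zero    = refl
  go (suc a) (suc n) = trans (go a n) (sym (ℤ.+-identityˡ _))

q^-cong : ∀ {a b} → a ≡ b → q^ a ≈ q^ b
q^-cong refl = ≈-refl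

powers : ℕ → ℕ → Series
powers k a = q^ (k ℕ.* a)

powers-+ : ∀ k a b → powers k (a ℕ.+ b) ≈ powers k a ⊛ powers k b
powers-+ k a b = ≈-trans (q^-cong (ℕ.*-distribˡ-+ k a b)) (q^-+ (k ℕ.* a) (k ℕ.* b))

f-limit-∏ : ∀ k .{{_ : NonZero k}} → ∏ (powers k) ⟶ f k
f-limit-∏ k {n} {N} n≤N = trans (sym (coeff (partialProduct≈∏ N) n)) (f-limit k n≤N)
  where
  partialProduct≈∏ : ∀ N → partialProduct k N ≈ ∏ (powers k) N
  partialProduct≈∏ zero    = ≈-refl
  partialProduct≈∏ (suc N) = *-congˡ {𝟙 ⊖ q^ (k ℕ.* suc N)} (partialProduct≈∏ N)

sign : ℕ → ℤ
sign n = -1ℤ ^ n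

sign-even : ∀ n → sign (n ℕ.* 2) ≡ 1ℤ
sign-even zero    = refl
sign-even (suc n) = cong (λ s → -1ℤ * (-1ℤ * s)) (sign-even n)

-- The power (-q)^a.
signedPowers : ℕ → Series
signedPowers a = const (sign a) ⊛ q^ a

signedPowers-+ : ∀ a b → signedPowers (a ℕ.+ b) ≈ signedPowers a ⊛ signedPowers b
signedPowers-+ a b = begin
  const (sign (a ℕ.+ b)) ⊛ q^ (a ℕ.+ b)
    ≈⟨ *-cong {const (sign (a ℕ.+ b))} {const (sign a) ⊛ const (sign b)}
         (≈-trans (reflexive (cong const (ℤ.^-distribˡ-+-* -1ℤ a b))) (*-homo (sign a) (sign b)))
         (q^-+ a b) ⟩
  const (sign a) ⊛ const (sign b) ⊛ (q^ a ⊛ q^ b)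
    ≈⟨ solve 4 (λ s t A B → s :* t :* (A :* B) := s :* A :* (t :* B)) ≈-refl
         (const (sign a)) (const (sign b)) (q^ a) (q^ b) ⟩
  signedPowers a ⊛ signedPowers b ∎
  where open ≈-Reasoning

signedPowers-even : ∀ n → signedPowers (n ℕ.* 2) ≈ q^ (n ℕ.* 2)
signedPowers-even n = coeffwise λ m → trans (const-⊛ (sign (n ℕ.* 2)) (q^ (n ℕ.* 2)) m)
  (trans (cong (_* q^ (n ℕ.* 2) m) (sign-even n)) (ℤ.*-identityˡ _))

signedPowers-odd : ∀ n → signedPowers (suc (n ℕ.* 2)) ≈ ⊝ q^ (suc (n ℕ.* 2))
signedPowers-odd n = coeffwise λ m → trans (const-⊛ (sign (suc (n ℕ.* 2))) (q^ (suc (n ℕ.* 2))) m)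
  (trans (cong (λ s → -1ℤ * s * q^ (suc (n ℕ.* 2)) m) (sign-even n)) (ℤ.-1*i≡-i _))

signedPowers-support : ∀ a n → signedPowers a n ≡ 0ℤ ⊎ n ≡ 1 ℕ.* a
signedPowers-support a n with q^-support a n
... | inj₁ eq = inj₁ (trans (const-⊛ (sign a) (q^ a) n)
  (trans (cong (sign a *_) eq) (ℤ.*-zeroʳ (sign a))))
... | inj₂ eq = inj₂ (trans eq (sym (ℕ.*-identityˡ a)))

signedPowers-square : ∀ n → signedPowers n ⊛ signedPowers n ≈ powers 2 n
signedPowers-square n = ≈-trans (≈-sym (signedPowers-+ n n)) (≈-trans
  (reflexive (cong signedPowers (trans (n+n n) (ℕ.*-comm 2 n))))
  (≈-trans (signedPowers-even n) (q^-cong (ℕ.*-comm n 2))))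
  where
  n+n : ∀ n → n ℕ.+ n ≡ 2 ℕ.* n
  n+n n = cong (n ℕ.+_) (sym (ℕ.+-identityʳ n))

-- For x = -q the signs (-1)^s and (-1)^(s²) cancel, so `Θ` is φ(q). For x = q² the sign (-1)^s
-- survives and `Θ` is φ(-q²).
module Φ = Gauss 1 signedPowers signedPowers-+ signedPowers-support
module U = Gauss 2 (powers 2) (powers-+ 2) (λ a → q^-support (2 ℕ.* a))

-- u is φ(-q²), and f₋ is f₁(-q).
φ u f₋ : Series
φ  = Φ.Θ
u  = U.Θ
f₋ = diagonal (∏ signedPowers)

diagonal≈f : ∀ k .{{_ : NonZero k}} → diagonal (∏ (powers k)) ≈ f k
diagonal≈f k = coeffwise λ n → f-limit-∏ k (ℕ.≤-refl {n})

powers-square : ∀ k n → powers k n ⊛ powers k n ≈ powers (k ℕ.* 2) n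
powers-square k n = ≈-trans (≈-sym (powers-+ k n n)) (q^-cong (lemma k n))
  where
  lemma : ∀ k n → k ℕ.* (n ℕ.+ n) ≡ k ℕ.* 2 ℕ.* n
  lemma = ℕ-solve-∀

powers-even : ∀ k n → powers k (n ℕ.* 2) ≈ powers (k ℕ.* 2) n
powers-even k n = q^-cong (lemma k n)
  where
  lemma : ∀ k n → k ℕ.* (n ℕ.* 2) ≡ k ℕ.* 2 ℕ.* n
  lemma = ℕ-solve-∀

φ-product : φ ⊛ f 2 ≈ f₋ ⊛ f₋
φ-product = ≈-trans (*-congˡ {φ} (≈-sym (diagonal≈f 2))) (Φ.gauss (powers 2) signedPowers-square)

u-product : u ⊛ f 4 ≈ f 2 ⊛ f 2
u-product = ≈-trans (*-congˡ {u} (≈-sym (diagonal≈f 4)))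
  (≈-trans (U.gauss (powers 4) (powers-square 2))
    (*-cong {diagonal (∏ (powers 2))} (diagonal≈f 2) (diagonal≈f 2)))

-- The limit of `∏-conjugate`. Its products have lengths n and 2n; those of length 2n converge as
-- subsequences.
f₋-product : f₋ ⊛ f 1 ⊛ f 4 ≈ f 2 ⊛ f 2 ⊛ f 2
f₋-product = ⟶-unique
  (⟶-⊛ (⟶-⊛ (⟶-subsequence double n≤2n (∏-limit signedPowers Φ.x-vanishes))
              (⟶-subsequence double n≤2n (f-limit-∏ 1)))
        (f-limit-∏ 4))
  (⟶-⊛ (⟶-⊛ (f-limit-∏ 2) (f-limit-∏ 2)) (⟶-subsequence double n≤2n (f-limit-∏ 2)))
  λ n → coeff (∏-conjugate signedPowers (powers 1) (powers 2) (powers 4)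
    (λ n → ≈-trans (signedPowers-even n) (≈-sym (1* (n ℕ.* 2))))
    (λ n → ≈-trans (signedPowers-odd n) (-‿cong (≈-sym (1* (suc (n ℕ.* 2))))))
    (powers-square 1) (powers-even 1) (powers-even 2) n) n
  where
  double = ℕ._* 2
  n≤2n : ∀ n → n ℕ.≤ n ℕ.* 2
  n≤2n n = ℕ.m≤m*n n 2
  1* : ∀ n → powers 1 n ≈ q^ n
  1* n = q^-cong (ℕ.*-identityˡ n)

-- The generating function as a quotient of theta functions

inverse-⊛ : ∀ a → a 0 ≡ 1ℤ → a ⊛ inverse a ≈ 𝟙
inverse-⊛ a a₀≡1 = coeffwise (inverse-correct a a₀≡1)

⊛-cancelʳ : ∀ {a b} c → c 0 ≡ 1ℤ → a ⊛ c ≈ b ⊛ c → a ≈ b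
⊛-cancelʳ {a} {b} c c₀≡1 ac≈bc = begin
  a                    ≈⟨ *-identityʳ a ⟨
  a ⊛ 𝟙                ≈⟨ *-congˡ {a} (inverse-⊛ c c₀≡1) ⟨
  a ⊛ (c ⊛ inverse c)  ≈⟨ *-assoc a c (inverse c) ⟨
  a ⊛ c ⊛ inverse c    ≈⟨ *-congʳ {inverse c} ac≈bc ⟩
  b ⊛ c ⊛ inverse c    ≈⟨ *-assoc b c (inverse c) ⟩
  b ⊛ (c ⊛ inverse c)  ≈⟨ *-congˡ {b} (inverse-⊛ c c₀≡1) ⟩
  b ⊛ 𝟙                ≈⟨ *-identityʳ b ⟩
  b                    ∎
  where open ≈-Reasoning

⊛-unit : ∀ a b → a 0 ≡ 1ℤ → b 0 ≡ 1ℤ → (a ⊛ b) 0 ≡ 1ℤ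
⊛-unit a b a₀≡1 b₀≡1 = cong₂ (λ x y → x * y + 0ℤ) a₀≡1 b₀≡1

^ℕ-unit : ∀ a → a 0 ≡ 1ℤ → ∀ n → (a ^ℕ n) 0 ≡ 1ℤ
^ℕ-unit a a₀≡1 zero    = refl
^ℕ-unit a a₀≡1 (suc n) = ⊛-unit a (a ^ℕ n) a₀≡1 (^ℕ-unit a a₀≡1 n)

^ℤ-unit : ∀ a → a 0 ≡ 1ℤ → ∀ z → (a ^ℤ z) 0 ≡ 1ℤ
^ℤ-unit a a₀≡1 (+ n)    = ^ℕ-unit a a₀≡1 n
^ℤ-unit a a₀≡1 -[1+ n ] = refl

^ℕ-cong : ∀ {a b} n → a ≈ b → a ^ℕ n ≈ b ^ℕ n
^ℕ-cong zero    a≈b = ≈-refl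
^ℕ-cong {a} {b} (suc n) a≈b = *-cong {a} {b} {a ^ℕ n} a≈b (^ℕ-cong n a≈b)

^ℕ-congʳ : ∀ a {m n} → m ≡ n → a ^ℕ m ≈ a ^ℕ n
^ℕ-congʳ a refl = ≈-refl

^ℕ-+ : ∀ a m n → a ^ℕ (m ℕ.+ n) ≈ a ^ℕ m ⊛ a ^ℕ n
^ℕ-+ a zero    n = ≈-sym (*-identityˡ (a ^ℕ n))
^ℕ-+ a (suc m) n = ≈-trans (*-congˡ {a} (^ℕ-+ a m n)) (≈-sym (*-assoc a (a ^ℕ m) (a ^ℕ n)))

^ℕ-* : ∀ a m n → a ^ℕ (m ℕ.* n) ≈ (a ^ℕ m) ^ℕ n
^ℕ-* a m zero    = ^ℕ-congʳ a (ℕ.*-zeroʳ m)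
^ℕ-* a m (suc n) = ≈-trans (^ℕ-congʳ a (ℕ.*-suc m n))
  (≈-trans (^ℕ-+ a m (m ℕ.* n)) (*-congˡ {a ^ℕ m} (^ℕ-* a m n)))

⊛-^ℕ : ∀ a b n → (a ⊛ b) ^ℕ n ≈ a ^ℕ n ⊛ b ^ℕ n
⊛-^ℕ a b zero    = ≈-sym (*-identityˡ 𝟙)
⊛-^ℕ a b (suc n) = ≈-trans (*-congˡ {a ⊛ b} (⊛-^ℕ a b n))
  (solve 4 (λ a b c d → a :* b :* (c :* d) := a :* c :* (b :* d)) ≈-refl a b (a ^ℕ n) (b ^ℕ n))

-- Clears a possibly negative exponent: if z = -(p + 1), then n = m + (p + 1), and a^(p + 1) cancels
-- the inverse.
^ℤ-^ℕ : ∀ {a} → a 0 ≡ 1ℤ → ∀ z n m → z + + n ≡ + m → a ^ℤ z ⊛ a ^ℕ n ≈ a ^ℕ m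
^ℤ-^ℕ {a} a₀≡1 (+ p) n m eq =
  ≈-trans (≈-sym (^ℕ-+ a p n)) (^ℕ-congʳ a (ℤ.+-injective eq))
^ℤ-^ℕ {a} a₀≡1 -[1+ p ] n m eq = begin
  inverse b ⊛ a ^ℕ n               ≈⟨ *-congˡ {inverse b} (^ℕ-congʳ a n≡) ⟩
  inverse b ⊛ a ^ℕ (m ℕ.+ suc p)   ≈⟨ *-congˡ {inverse b} (^ℕ-+ a m (suc p)) ⟩
  inverse b ⊛ (a ^ℕ m ⊛ b)
    ≈⟨ solve 3 (λ i x y → i :* (x :* y) := x :* (y :* i)) ≈-refl (inverse b) (a ^ℕ m) b ⟩
  a ^ℕ m ⊛ (b ⊛ inverse b)         ≈⟨ *-congˡ {a ^ℕ m} (inverse-⊛ b (^ℕ-unit a a₀≡1 (suc p))) ⟩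
  a ^ℕ m ⊛ 𝟙                       ≈⟨ *-identityʳ (a ^ℕ m) ⟩
  a ^ℕ m                           ∎
  where
  open ≈-Reasoning
  b = a ^ℕ suc p
  n≡ : n ≡ m ℕ.+ suc p
  n≡ = ℤ.+-injective (trans (lemma (+ n) (+ suc p)) (cong (_+ + suc p) eq))
    where
    lemma : ∀ x y → x ≡ (- y + x) + y
    lemma = solve-∀

φ-product′ : φ ⊛ (f 1 ⊛ f 1 ⊛ (f 4 ⊛ f 4)) ≈ f 2 ⊛ f 2 ⊛ f 2 ⊛ f 2 ⊛ f 2
φ-product′ = ⊛-cancelʳ (f 2) refl
  (eliminate-conjugate φ (f 1) (f 2) f₋ (f 4) φ-product f₋-product)

f₂-even-power : ∀ m → f 2 ^ℕ (2 ℕ.* m) ≈ u ^ℕ m ⊛ f 4 ^ℕ m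
f₂-even-power m = begin
  f 2 ^ℕ (2 ℕ.* m)          ≈⟨ ^ℕ-* (f 2) 2 m ⟩
  (f 2 ⊛ (f 2 ⊛ 𝟙)) ^ℕ m    ≈⟨ ^ℕ-cong m (*-congˡ {f 2} (*-identityʳ (f 2))) ⟩
  (f 2 ⊛ f 2) ^ℕ m          ≈⟨ ^ℕ-cong m u-product ⟨
  (u ⊛ f 4) ^ℕ m            ≈⟨ ⊛-^ℕ u (f 4) m ⟩
  u ^ℕ m ⊛ f 4 ^ℕ m         ∎
  where open ≈-Reasoning

ā-product : ∀ c → ā c ⊛ ((f 1 ^ℤ + 2) ⊛ (f 2 ^ℤ (+ 2 * c - + 3))) ≈ f 4 ^ℤ (c - + 1)
ā-product c = begin
  C ⊛ inverse K ⊛ K    ≈⟨ solve 3 (λ c i k → c :* i :* k := c :* (k :* i)) ≈-refl C (inverse K) K ⟩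
  C ⊛ (K ⊛ inverse K)
    ≈⟨ *-congˡ {C} (inverse-⊛ K (⊛-unit (f 1 ^ℤ + 2) (f 2 ^ℤ (+ 2 * c - + 3)) refl
         (^ℤ-unit (f 2) refl (+ 2 * c - + 3)))) ⟩
  C ⊛ 𝟙                ≈⟨ *-identityʳ C ⟩
  C                    ∎
  where
  open ≈-Reasoning
  C = f 4 ^ℤ (c - + 1)
  K = (f 1 ^ℤ + 2) ⊛ (f 2 ^ℤ (+ 2 * c - + 3))

-- This is ā_c = φ / u^(c + 1) with c + 1 = m - 2e, multiplied by u^m. The exponents match because
-- (2c - 3) + 5 + 4e = 2m and (c - 1) + 2 + 2e = m.
ā-theta : ∀ c m e → c + + (1 ℕ.+ 2 ℕ.* e) ≡ + m → ā c ⊛ u ^ℕ m ≈ φ ⊛ u ^ℕ (2 ℕ.* e)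
ā-theta c m e eq = ⊛-cancelʳ K K₀≡1 (eliminate-products (ā c) B C (f 1) (f 2) (f 4) φ
    (f 2 ^ℕ (2 ℕ.* m)) (f 4 ^ℕ m) (f 2 ^ℕ (2 ℕ.* (2 ℕ.* e))) (f 4 ^ℕ (2 ℕ.* e))
      (u ^ℕ m) (u ^ℕ (2 ℕ.* e))
    (ā-product c)
    (≈-trans (*-congˡ {B} (≈-sym (^ℕ-+ (f 2) 5 (2 ℕ.* (2 ℕ.* e)))))
      (^ℤ-^ℕ {f 2} refl (+ 2 * c - + 3) (5 ℕ.+ 2 ℕ.* (2 ℕ.* e)) (2 ℕ.* m) B-exponent))
    (≈-trans (*-congˡ {C} (≈-sym (^ℕ-+ (f 4) 2 (2 ℕ.* e))))
      (^ℤ-^ℕ {f 4} refl (c - + 1) (2 ℕ.+ 2 ℕ.* e) m C-exponent))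
    (f₂-even-power m) (f₂-even-power (2 ℕ.* e)) φ-product′)
  where
  B = f 2 ^ℤ (+ 2 * c - + 3)
  C = f 4 ^ℤ (c - + 1)
  K = f 1 ⊛ f 1 ⊛ (f 4 ⊛ f 4) ⊛ (f 4 ^ℕ (2 ℕ.* e) ⊛ f 4 ^ℕ m)
  K₀≡1 : K 0 ≡ 1ℤ
  K₀≡1 = ⊛-unit (f 1 ⊛ f 1 ⊛ (f 4 ⊛ f 4)) (f 4 ^ℕ (2 ℕ.* e) ⊛ f 4 ^ℕ m) refl
    (⊛-unit (f 4 ^ℕ (2 ℕ.* e)) (f 4 ^ℕ m) (^ℕ-unit (f 4) refl (2 ℕ.* e)) (^ℕ-unit (f 4) refl m))
  B-exponent : + 2 * c - + 3 + + (5 ℕ.+ 2 ℕ.* (2 ℕ.* e)) ≡ + (2 ℕ.* m)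
  B-exponent = begin
    + 2 * c - + 3 + + (5 ℕ.+ 2 ℕ.* (2 ℕ.* e))
      ≡⟨ cong (λ t → + 2 * c - + 3 + (+ 5 + t))
        (trans (ℤ.pos-* 2 (2 ℕ.* e)) (cong (λ t → + 2 * t) (ℤ.pos-* 2 e))) ⟩
    + 2 * c - + 3 + (+ 5 + + 2 * (+ 2 * + e))
      ≡⟨ lemma c (+ e) ⟩
    + 2 * (c + (+ 1 + + 2 * + e))
      ≡⟨ cong (λ t → + 2 * (c + (+ 1 + t))) (ℤ.pos-* 2 e) ⟨
    + 2 * (c + + (1 ℕ.+ 2 ℕ.* e))
      ≡⟨ cong (λ t → + 2 * t) eq ⟩
    + 2 * + m
      ≡⟨ ℤ.pos-* 2 m ⟨
    + (2 ℕ.* m) ∎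
    where
    open ≡-Reasoning
    lemma : ∀ c e → + 2 * c - + 3 + (+ 5 + + 2 * (+ 2 * e)) ≡ + 2 * (c + (+ 1 + + 2 * e))
    lemma = solve-∀
  C-exponent : c - + 1 + + (2 ℕ.+ 2 ℕ.* e) ≡ + m
  C-exponent = trans (lemma c (+ (2 ℕ.* e))) eq
    where
    lemma : ∀ c t → c - + 1 + (+ 2 + t) ≡ c + (+ 1 + t)
    lemma = solve-∀

-- Residues of exponents modulo 8

-- Used with two choices of `P`: being zero unless n has a given residue, for supports, and
-- divisibility, for the congruence.
⊛-closed : (P : ℤ → Set) → P 0ℤ → (∀ {x y} → P x → P y → P (x + y)) →
           ∀ a b n → (∀ i j → i ℕ.+ j ≡ n → P (a i * b j)) → P ((a ⊛ b) n)
⊛-closed P P0 P+ a b zero    h = P+ (h 0 0 refl) P0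
⊛-closed P P0 P+ a b (suc n) h = P+ (h 0 (suc n) refl)
  (⊛-closed P P0 P+ (tail a) b n λ i j i+j≡n → h (suc i) j (cong suc i+j≡n))

module _ (m : ℕ) .{{_ : NonZero m}} where

  Homogeneous : ℕ → Series → Set
  Homogeneous r a = ∀ n → a n ≡ 0ℤ ⊎ n ℕ.% m ≡ r

  homogeneous-⊛ : ∀ {r s a b} → Homogeneous r a → Homogeneous s b →
                  Homogeneous ((r ℕ.+ s) ℕ.% m) (a ⊛ b)
  homogeneous-⊛ {r} {s} {a} {b} ha hb n = ⊛-closed
    (λ z → z ≡ 0ℤ ⊎ n ℕ.% m ≡ (r ℕ.+ s) ℕ.% m) (inj₁ refl)
    (λ { (inj₁ p) (inj₁ q) → inj₁ (cong₂ _+_ p q) ; (inj₂ p) _ → inj₂ p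
      ; (inj₁ _) (inj₂ q) → inj₂ q })
    a b n term
    where
    term : ∀ i j → i ℕ.+ j ≡ n → a i * b j ≡ 0ℤ ⊎ n ℕ.% m ≡ (r ℕ.+ s) ℕ.% m
    term i j refl with ha i | hb j
    ... | inj₁ p | _      = inj₁ (cong (_* b j) p)
    ... | inj₂ _ | inj₁ q = inj₁ (trans (cong (a i *_) q) (ℤ.*-zeroʳ (a i)))
    ... | inj₂ p | inj₂ q = inj₂ (trans (ℕ.%-distribˡ-+ i j m) (cong₂ (λ r s → (r ℕ.+ s) ℕ.% m) p q))

  homogeneous-⊕ : ∀ {r a b} → Homogeneous r a → Homogeneous r b → Homogeneous r (a ⊕ b)
  homogeneous-⊕ ha hb n with ha n | hb n
  ... | inj₁ p | inj₁ q = inj₁ (cong₂ _+_ p q)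
  ... | inj₂ p | _      = inj₂ p
  ... | inj₁ _ | inj₂ q = inj₂ q

  homogeneous-const : ∀ z → Homogeneous (0 ℕ.% m) (const z)
  homogeneous-const z zero    = inj₂ refl
  homogeneous-const z (suc n) = inj₁ refl

  homogeneous-𝟙 : Homogeneous (0 ℕ.% m) 𝟙
  homogeneous-𝟙 zero    = inj₂ refl
  homogeneous-𝟙 (suc n) = inj₁ refl

  homogeneous-𝟘 : ∀ {r} → Homogeneous r 𝟘
  homogeneous-𝟘 n = inj₁ refl

even-^ℕ : ∀ {a} → Homogeneous 2 0 a → ∀ n → Homogeneous 2 0 (a ^ℕ n)
even-^ℕ ha zero    = homogeneous-𝟙 2
even-^ℕ {a} ha (suc n) = homogeneous-⊛ 2 {a = a} {b = a ^ℕ n} ha (even-^ℕ ha n)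

select : ℕ → Series → Series
select r a n with n ℕ.% 8 ℕ.≟ r
... | yes _ = a n
... | no  _ = 0ℤ

select-homogeneous : ∀ r a → Homogeneous 8 r (select r a)
select-homogeneous r a n with n ℕ.% 8 ℕ.≟ r
... | yes p = inj₂ p
... | no  _ = inj₁ refl

select-split : ∀ a → (∀ n → a n ≡ 0ℤ ⊎ n ℕ.% 8 ≡ 0 ⊎ n ℕ.% 8 ≡ 2) → a ≈ select 0 a ⊕ select 2 a
select-split a supp = coeffwise go
  where
  go : ∀ n → a n ≡ select 0 a n + select 2 a n
  go n with n ℕ.% 8 ℕ.≟ 0 | n ℕ.% 8 ℕ.≟ 2 | supp n
  ... | yes p | yes q | _ with () ← trans (sym p) q
  ... | yes _ | no _  | _ = sym (ℤ.+-identityʳ (a n))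
  ... | no _  | yes _ | _ = sym (ℤ.+-identityˡ (a n))
  ... | no _  | no _  | inj₁ p = p
  ... | no ¬p | no _  | inj₂ (inj₁ p) = ⊥-elim (¬p p)
  ... | no _  | no ¬q | inj₂ (inj₂ q) = ⊥-elim (¬q q)

-- Since (t + 4)² = t² + 8 (t + 2), four cases decide. For even s only the parity of the square is
-- kept.
square-residue : ∀ s → (s ℕ.* s) ℕ.% 2 ≡ 0 ⊎ (s ℕ.* s) ℕ.% 8 ≡ 1
square-residue 0 = inj₁ refl
square-residue 1 = inj₂ refl
square-residue 2 = inj₁ refl
square-residue 3 = inj₂ refl
square-residue (suc (suc (suc (suc t)))) with square-residue t
... | inj₁ p = inj₁ (trans (cong (ℕ._% 2) (lemma t))
  (trans (ℕ.[m+kn]%n≡m%n (t ℕ.* t) (4 ℕ.* (t ℕ.+ 2)) 2) p))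
  where
  lemma : ∀ t → (4 ℕ.+ t) ℕ.* (4 ℕ.+ t) ≡ t ℕ.* t ℕ.+ 4 ℕ.* (t ℕ.+ 2) ℕ.* 2
  lemma = ℕ-solve-∀
... | inj₂ p = inj₂ (trans (cong (ℕ._% 8) (lemma t))
  (trans (ℕ.[m+kn]%n≡m%n (t ℕ.* t) (t ℕ.+ 2) 8) p))
  where
  lemma : ∀ t → (4 ℕ.+ t) ℕ.* (4 ℕ.+ t) ≡ t ℕ.* t ℕ.+ (t ℕ.+ 2) ℕ.* 8
  lemma = ℕ-solve-∀

double-square-residue : ∀ s → (2 ℕ.* (s ℕ.* s)) ℕ.% 8 ≡ 0 ⊎ (2 ℕ.* (s ℕ.* s)) ℕ.% 8 ≡ 2
double-square-residue 0 = inj₁ refl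
double-square-residue 1 = inj₂ refl
double-square-residue (suc (suc t)) with double-square-residue t
... | h = subst (λ r → r ≡ 0 ⊎ r ≡ 2) (sym (trans (cong (ℕ._% 8) (lemma t))
            (ℕ.[m+kn]%n≡m%n (2 ℕ.* (t ℕ.* t)) (t ℕ.+ 1) 8))) h
  where
  lemma : ∀ t → 2 ℕ.* ((2 ℕ.+ t) ℕ.* (2 ℕ.+ t)) ≡ 2 ℕ.* (t ℕ.* t) ℕ.+ (t ℕ.+ 1) ℕ.* 8
  lemma = ℕ-solve-∀

SupportedOnSquares : ℕ → Series → Set
SupportedOnSquares d a = ∀ n → a n ≡ 0ℤ ⊎ (∃[ s ] n ≡ d ℕ.* (s ℕ.* s))

-- Nothing is claimed at even exponents, including the constant term 1: in a coefficient at 8n + 7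
-- they meet odd exponents of an even series.
theta-coefficient : ∀ {a} → SupportedOnSquares 1 a → let t = 𝟙 ⊕ const (+ 2) ⊛ a in
                    ∀ n → t n ≡ 0ℤ ⊎ n ℕ.% 2 ≡ 0 ⊎ (n ℕ.% 8 ≡ 1 × + 2 ∣ₛ t n)
theta-coefficient {a} supp zero      = inj₂ (inj₁ refl)
theta-coefficient {a} supp n@(suc m) with supp n
... | inj₁ eq = inj₁ (trans (ℤ.+-identityˡ _) (trans (const-⊛ (+ 2) a n) (cong (λ t → + 2 * t) eq)))
... | inj₂ (s , eq) with square-residue s
... | inj₁ even = inj₂ (inj₁ (trans (cong (ℕ._% 2) (trans eq (ℕ.*-identityˡ (s ℕ.* s)))) even))
... | inj₂ one  = inj₂ (inj₂ (trans (cong (ℕ._% 8) (trans eq (ℕ.*-identityˡ (s ℕ.* s)))) one ,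
  divides (a n) (trans (ℤ.+-identityˡ _) (trans (const-⊛ (+ 2) a n) (ℤ.*-comm (+ 2) (a n))))))

φ-coefficient : ∀ n → φ n ≡ 0ℤ ⊎ n ℕ.% 2 ≡ 0 ⊎ (n ℕ.% 8 ≡ 1 × + 2 ∣ₛ φ n)
φ-coefficient = theta-coefficient {Φ.S∞} (λ n → Φ.S-support n n)

supported-even : ∀ {a} → SupportedOnSquares 2 a → Homogeneous 2 0 a
supported-even supp n with supp n
... | inj₁ eq       = inj₁ eq
... | inj₂ (s , eq) = inj₂ (trans (cong (ℕ._% 2) (trans eq (ℕ.*-comm 2 (s ℕ.* s))))
  (ℕ.m*n%n≡0 (s ℕ.* s) 2))

supported-split : ∀ {a} → SupportedOnSquares 2 a → a ≈ select 0 a ⊕ select 2 a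
supported-split {a} supp = select-split a residue
  where
  residue : ∀ n → a n ≡ 0ℤ ⊎ n ℕ.% 8 ≡ 0 ⊎ n ℕ.% 8 ≡ 2
  residue n with supp n
  ... | inj₁ eq       = inj₁ eq
  ... | inj₂ (s , eq) = inj₂ (subst (λ k → k ℕ.% 8 ≡ 0 ⊎ k ℕ.% 8 ≡ 2) (sym eq)
    (double-square-residue s))

u-support : SupportedOnSquares 2 U.S∞
u-support n = U.S-support n n

u-even : Homogeneous 2 0 u
u-even = homogeneous-⊕ 2 {a = 𝟙} {b = const (+ 2) ⊛ U.S∞} (homogeneous-𝟙 2)
  (homogeneous-⊛ 2 {a = const (+ 2)} {b = U.S∞} (homogeneous-const 2 (+ 2))
    (supported-even {U.S∞} u-support))

S₀ S₂ : Series
S₀ = select 0 U.S∞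
S₂ = select 2 U.S∞

u-split : u ≈ 𝟙 ⊕ const (+ 2) ⊛ (S₀ ⊕ S₂)
u-split = +-congˡ {𝟙} (*-congˡ {const (+ 2)} (supported-split {U.S∞} u-support))

-- Powers of series congruent to 1 modulo powers of 2.

OneMod : ℤ → Series → Set
OneMod p g = ∃[ Z ] g ≈ 𝟙 ⊕ const p ⊛ Z

oneMod-⊛ : ∀ p {g h} → OneMod p g → OneMod p h → OneMod p (g ⊛ h)
oneMod-⊛ p {g} {h} (Y , g≈) (Z , h≈) = Y ⊕ Z ⊕ const p ⊛ Y ⊛ Z , ≈-trans
  (*-cong {g} {𝟙 ⊕ const p ⊛ Y} {h} {𝟙 ⊕ const p ⊛ Z} g≈ h≈)
  (solve 3 (λ p Y Z → (:1 :+ p :* Y) :* (:1 :+ p :* Z) := :1 :+ p :* (Y :+ Z :+ p :* Y :* Z))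
    ≈-refl (const p) Y Z)

oneMod-^ℕ : ∀ p {g} → OneMod p g → ∀ n → OneMod p (g ^ℕ n)
oneMod-^ℕ p g₁ zero    = const 0ℤ , solve 1 (λ p → :1 := :1 :+ p :* con 0ℤ) ≈-refl (const p)
oneMod-^ℕ p g₁ (suc n) = oneMod-⊛ p g₁ (oneMod-^ℕ p g₁ n)

-- An even modulus doubles on squaring: (1 + 2rZ)² = 1 + 4r (Z + rZ²).
oneMod-square : ∀ r {g} → OneMod (+ 2 * r) g → OneMod (+ 2 * (+ 2 * r)) (g ⊛ g)
oneMod-square r {g} (Z , g≈) = Z ⊕ const r ⊛ Z ⊛ Z , (begin
  g ⊛ g
    ≈⟨ *-cong {g} {𝟙 ⊕ const 2r ⊛ Z} {g} {𝟙 ⊕ const 2r ⊛ Z} g≈ g≈ ⟩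
  (𝟙 ⊕ const 2r ⊛ Z) ⊛ (𝟙 ⊕ const 2r ⊛ Z)
    ≈⟨ *-cong {𝟙 ⊕ const 2r ⊛ Z} {X} {𝟙 ⊕ const 2r ⊛ Z} {X} X≈ X≈ ⟩
  X ⊛ X
    ≈⟨ solve 2 (λ r Z → (:1 :+ con (+ 2) :* r :* Z) :* (:1 :+ con (+ 2) :* r :* Z)
         := :1 :+ con (+ 2) :* (con (+ 2) :* r) :* (Z :+ r :* Z :* Z)) ≈-refl (const r) Z ⟩
  𝟙 ⊕ const (+ 2) ⊛ (const (+ 2) ⊛ const r) ⊛ Z′
    ≈⟨ +-congˡ {𝟙} (*-congʳ {Z′} (≈-sym
      (≈-trans (*-homo (+ 2) 2r) (*-congˡ {const (+ 2)} (*-homo (+ 2) r))))) ⟩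
  𝟙 ⊕ const (+ 2 * 2r) ⊛ Z′ ∎)
  where
  open ≈-Reasoning
  2r = + 2 * r
  X  = 𝟙 ⊕ const (+ 2) ⊛ const r ⊛ Z
  Z′ = Z ⊕ const r ⊛ Z ⊛ Z
  X≈ : 𝟙 ⊕ const 2r ⊛ Z ≈ X
  X≈ = +-congˡ {𝟙} (*-congʳ {Z} (*-homo (+ 2) r))

^ℕ-double : ∀ a n → a ^ℕ (2 ℕ.* n) ≈ a ^ℕ n ⊛ a ^ℕ n
^ℕ-double a n = ≈-trans (^ℕ-congʳ a (cong (n ℕ.+_) (ℕ.+-identityʳ n))) (^ℕ-+ a n n)

oneMod-≈ : ∀ p {g h} → g ≈ h → OneMod p g → OneMod p h
oneMod-≈ p g≈h (Z , g≈) = Z , ≈-trans (≈-sym g≈h) g≈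

oneMod-^2^ : ∀ {g} → OneMod (+ 2) g → ∀ l → OneMod ((+ 2) ^ suc l) (g ^ℕ (2 ℕ.^ l))
oneMod-^2^ {g} g₁ zero    = oneMod-≈ (+ 2) (≈-sym (*-identityʳ g)) g₁
oneMod-^2^ {g} g₁ (suc l) = oneMod-≈ ((+ 2) ^ suc (suc l)) (≈-sym (^ℕ-double g (2 ℕ.^ l)))
  (oneMod-square ((+ 2) ^ l) (oneMod-^2^ g₁ l))

-- In the application `p` is 2^l and `g` is a power of u^(2^(l+1)). Modulo 16p no exponent of
-- residue 6 occurs; `R` is unrestricted and collects whatever would violate this.
record Graded (p : ℤ) (g : Series) : Set where
  field
    {X₀ X₂ X₄ R} : Series
    h₀ : Homogeneous 8 0 X₀
    h₂ : Homogeneous 8 2 X₂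
    h₄ : Homogeneous 8 4 X₄
    expansion : g ≈ 𝟙 ⊕ const (+ 4) ⊛ const p ⊛ (X₀ ⊕ X₂ ⊕ X₄ ⊕ const (+ 4) ⊛ R)

graded-𝟙 : ∀ p → Graded p 𝟙
graded-𝟙 p = record
  { X₀ = 𝟘 ; X₂ = 𝟘 ; X₄ = 𝟘 ; R = 𝟘
  ; h₀ = homogeneous-𝟘 8 ; h₂ = homogeneous-𝟘 8 ; h₄ = homogeneous-𝟘 8
  ; expansion = ≈-sym (≈-trans (+-congˡ {𝟙} (≈-trans (*-congˡ {K} zeros) (zeroʳ K)))
    (+-identityʳ 𝟙)) }
  where
  K = const (+ 4) ⊛ const p
  zeros : 𝟘 ⊕ 𝟘 ⊕ 𝟘 ⊕ const (+ 4) ⊛ 𝟘 ≈ 𝟘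
  zeros = ≈-trans (+-identityˡ (const (+ 4) ⊛ 𝟘)) (zeroʳ (const (+ 4)))

-- The cross term (4p Y)(4p Z) is divisible by 16p and goes into `R`, so the graded parts simply
-- add.
graded-⊛ : ∀ {p g h} → Graded p g → Graded p h → Graded p (g ⊛ h)
graded-⊛ {p} {g} {h} G H = record
  { X₀ = G.X₀ ⊕ H.X₀ ; X₂ = G.X₂ ⊕ H.X₂ ; X₄ = G.X₄ ⊕ H.X₄
  ; R  = G.R ⊕ H.R ⊕ const p ⊛ Y ⊛ Z
  ; h₀ = homogeneous-⊕ 8 {a = G.X₀} {b = H.X₀} G.h₀ H.h₀
  ; h₂ = homogeneous-⊕ 8 {a = G.X₂} {b = H.X₂} G.h₂ H.h₂
  ; h₄ = homogeneous-⊕ 8 {a = G.X₄} {b = H.X₄} G.h₄ H.h₄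
  ; expansion = ≈-trans
      (*-cong {g} {𝟙 ⊕ const (+ 4) ⊛ const p ⊛ Y}
        {h} {𝟙 ⊕ const (+ 4) ⊛ const p ⊛ Z} G.expansion H.expansion)
      (solve 9 (λ p a b c r a′ b′ c′ r′ →
         let y = a :+ b :+ c :+ con (+ 4) :* r
             z = a′ :+ b′ :+ c′ :+ con (+ 4) :* r′ in
         (:1 :+ con (+ 4) :* p :* y) :* (:1 :+ con (+ 4) :* p :* z)
         := :1 :+ con (+ 4) :* p :* ((a :+ a′) :+ (b :+ b′) :+ (c :+ c′)
              :+ con (+ 4) :* (r :+ r′ :+ p :* y :* z)))
        ≈-refl (const p) G.X₀ G.X₂ G.X₄ G.R H.X₀ H.X₂ H.X₄ H.R) }
  where
  module G = Graded G
  module H = Graded H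
  Y = G.X₀ ⊕ G.X₂ ⊕ G.X₄ ⊕ const (+ 4) ⊛ G.R
  Z = H.X₀ ⊕ H.X₂ ⊕ H.X₄ ⊕ const (+ 4) ⊛ H.R

graded-^ℕ : ∀ {p g} → Graded p g → ∀ n → Graded p (g ^ℕ n)
graded-^ℕ {p} G zero    = graded-𝟙 p
graded-^ℕ     G (suc n) = graded-⊛ G (graded-^ℕ G n)

graded-≈ : ∀ {p g h} → g ≈ h → Graded p g → Graded p h
graded-≈ g≈h G =
  record { Graded G hiding (expansion) ; expansion = ≈-trans (≈-sym g≈h) (Graded.expansion G) }

-- With z the bracket in `expansion`, the square is 1 + 8p (z + 2p z²). In z² the squares of `X₀`
-- and `X₄` have residue 0 and that of `X₂` has residue 4. The mixed products, among them `X₂ ⊛ X₄`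
-- of residue 6, come with 4p and go into `R`.
graded-square : ∀ {p g} → Graded p g → Graded (+ 2 * p) (g ⊛ g)
graded-square {p} {g} G = record
  { X₀ = X₀ ⊕ const (+ 2) ⊛ P ⊛ (X₀ ⊛ X₀ ⊕ X₄ ⊛ X₄)
  ; X₂ = X₂
  ; X₄ = X₄ ⊕ const (+ 2) ⊛ P ⊛ (X₂ ⊛ X₂)
  ; R  = P ⊛ (X₀ ⊛ X₂ ⊕ X₀ ⊛ X₄ ⊕ X₂ ⊛ X₄)
    ⊕ const (+ 4) ⊛ P ⊛ (X₀ ⊕ X₂ ⊕ X₄) ⊛ R ⊕ R ⊕ const (+ 8) ⊛ P ⊛ R ⊛ R
  ; h₀ = homogeneous-⊕ 8 {a = X₀} {b = const (+ 2) ⊛ P ⊛ (X₀ ⊛ X₀ ⊕ X₄ ⊛ X₄)} h₀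
           (homogeneous-⊛ 8 {a = const (+ 2) ⊛ P} {b = X₀ ⊛ X₀ ⊕ X₄ ⊛ X₄} h2P
             (homogeneous-⊕ 8 {a = X₀ ⊛ X₀} {b = X₄ ⊛ X₄}
               (homogeneous-⊛ 8 {a = X₀} {b = X₀} h₀ h₀) (homogeneous-⊛ 8 {a = X₄} {b = X₄} h₄ h₄)))
  ; h₂ = h₂
  ; h₄ = homogeneous-⊕ 8 {a = X₄} {b = const (+ 2) ⊛ P ⊛ (X₂ ⊛ X₂)} h₄
           (homogeneous-⊛ 8 {a = const (+ 2) ⊛ P} {b = X₂ ⊛ X₂} h2P
             (homogeneous-⊛ 8 {a = X₂} {b = X₂} h₂ h₂))
  ; expansion = ≈-trans (*-cong {g} {A} {g} {A} expansion expansion) (≈-trans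
      (solve 5 (λ p a b c r →
         let z  = a :+ b :+ c :+ con (+ 4) :* r
             2p = con (+ 2) :* p in
         (:1 :+ con (+ 4) :* p :* z) :* (:1 :+ con (+ 4) :* p :* z)
         := :1 :+ con (+ 4) :* 2p :* ((a :+ 2p :* (a :* a :+ c :* c)) :+ b :+ (c :+ 2p :* (b :* b))
              :+ con (+ 4) :* (p :* (a :* b :+ a :* c :+ b :* c)
                   :+ con (+ 4) :* p :* (a :+ b :+ c) :* r :+ r :+ con (+ 8) :* p :* r :* r)))
        ≈-refl P X₀ X₂ X₄ R)
      (+-congˡ {𝟙} (*-congʳ (*-congˡ {const (+ 4)} (≈-sym (*-homo (+ 2) p)))))) }
  where
  open Graded G
  P = const p
  A = 𝟙 ⊕ const (+ 4) ⊛ const p ⊛ (X₀ ⊕ X₂ ⊕ X₄ ⊕ const (+ 4) ⊛ R)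
  h2P : Homogeneous 8 0 (const (+ 2) ⊛ P)
  h2P = homogeneous-⊛ 8 {a = const (+ 2)} {b = P} (homogeneous-const 8 (+ 2)) (homogeneous-const 8 p)

graded-^2^ : ∀ {g} → Graded 1ℤ (g ^ℕ 2) → ∀ l → Graded ((+ 2) ^ l) (g ^ℕ (2 ℕ.^ suc l))
graded-^2^     G zero    = G
graded-^2^ {g} G (suc l) = graded-≈ (≈-sym (^ℕ-double g (2 ℕ.^ suc l)))
  (graded-square (graded-^2^ G l))

-- Coefficients at exponents congruent to 6 modulo 8.

VanishesAtSix : Series → Set
VanishesAtSix a = ∀ n → n ℕ.% 8 ≡ 6 → a n ≡ 0ℤ

homogeneous-vanishes : ∀ {r a} → ¬ r ≡ 6 → Homogeneous 8 r a → VanishesAtSix a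
homogeneous-vanishes r≢6 ha n n≡6 with ha n
... | inj₁ eq = eq
... | inj₂ eq = ⊥-elim (r≢6 (trans (sym eq) n≡6))

vanishes-⊕ : ∀ {a b} → VanishesAtSix a → VanishesAtSix b → VanishesAtSix (a ⊕ b)
vanishes-⊕ va vb n n≡6 = cong₂ _+_ (va n n≡6) (vb n n≡6)

vanishes-const : ∀ z {a} → VanishesAtSix a → VanishesAtSix (const z ⊛ a)
vanishes-const z {a} va n n≡6 =
  trans (const-⊛ z a n) (trans (cong (λ t → z * t) (va n n≡6)) (ℤ.*-zeroʳ z))

vanishes-𝟙 : VanishesAtSix 𝟙
vanishes-𝟙 = homogeneous-vanishes (λ ()) (homogeneous-𝟙 8)

DivisibleAtSix : ℤ → Series → Set
DivisibleAtSix m a = ∀ n → n ℕ.% 8 ≡ 6 → m ∣ₛ a n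

divisible-at-six : ∀ {m g a b} → g ≈ a ⊕ const m ⊛ b → VanishesAtSix a → DivisibleAtSix m g
divisible-at-six {m} {g} {a} {b} g≈ va n n≡6 = divides (b n) (begin
  g n                       ≡⟨ coeff g≈ n ⟩
  a n + (const m ⊛ b) n     ≡⟨ cong₂ _+_ (va n n≡6) (const-⊛ m b n) ⟩
  0ℤ + m * b n              ≡⟨ ℤ.+-identityˡ (m * b n) ⟩
  m * b n                   ≡⟨ ℤ.*-comm m (b n) ⟩
  b n * m                   ∎)
  where open ≡-Reasoning

-- The factor `v` is u^(2e). Multiplied out, all terms except 1 + 4V + 4pX are divisible by 16p, and
-- these exceptions avoid the residue 6.
graded-divisible : ∀ {p g v V} → Graded p g → v ≈ 𝟙 ⊕ const (+ 4) ⊛ V → VanishesAtSix V →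
                   DivisibleAtSix (+ 16 * p) (g ⊛ v)
graded-divisible {p} {g} {v} {V} G v≈ V-van = divisible-at-six {+ 16 * p} {g ⊛ v}
  {𝟙 ⊕ const (+ 4) ⊛ (V ⊕ P ⊛ X)} {R ⊕ V ⊛ (X ⊕ const (+ 4) ⊛ R)}
  (≈-trans (*-cong {g} {𝟙 ⊕ const (+ 4) ⊛ P ⊛ (X ⊕ const (+ 4) ⊛ R)}
    {v} {𝟙 ⊕ const (+ 4) ⊛ V} expansion v≈)
    (≈-trans
      (solve 4 (λ p x r v →
         (:1 :+ con (+ 4) :* p :* (x :+ con (+ 4) :* r)) :* (:1 :+ con (+ 4) :* v)
         := :1 :+ con (+ 4) :* (v :+ p :* x) :+ con (+ 16) :* p :* (r :+ v :* (x :+ con (+ 4) :* r)))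
        ≈-refl P X R V)
      (+-congˡ {𝟙 ⊕ const (+ 4) ⊛ (V ⊕ P ⊛ X)} (*-congʳ (≈-sym (*-homo (+ 16) p))))))
  (vanishes-⊕ {𝟙} {const (+ 4) ⊛ (V ⊕ P ⊛ X)} vanishes-𝟙
    (vanishes-const (+ 4) {V ⊕ P ⊛ X} (vanishes-⊕ {V} {P ⊛ X} V-van (vanishes-const p {X}
      (vanishes-⊕ {X₀ ⊕ X₂} {X₄} (vanishes-⊕ {X₀} {X₂}
        (homogeneous-vanishes {a = X₀} (λ ()) h₀) (homogeneous-vanishes {a = X₂} (λ ()) h₂))
        (homogeneous-vanishes {a = X₄} (λ ()) h₄))))))
  where
  open Graded G
  P = const p
  X = X₀ ⊕ X₂ ⊕ X₄

-- To be applied to `u`, with `S₀` and `S₂` as the two parts.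
module _ {g a₀ a₂} (h₀ : Homogeneous 8 0 a₀) (h₂ : Homogeneous 8 2 a₂)
  (g≈ : g ≈ 𝟙 ⊕ const (+ 2) ⊛ (a₀ ⊕ a₂)) where

  private
    a₀² : Homogeneous 8 0 (a₀ ⊛ a₀)
    a₀² = homogeneous-⊛ 8 {a = a₀} {b = a₀} h₀ h₀

    a₀a₂ : Homogeneous 8 2 (const (+ 2) ⊛ (a₀ ⊛ a₂))
    a₀a₂ = homogeneous-⊛ 8 {a = const (+ 2)} {b = a₀ ⊛ a₂} (homogeneous-const 8 (+ 2))
      (homogeneous-⊛ 8 {a = a₀} {b = a₂} h₀ h₂)

    a₂² : Homogeneous 8 4 (a₂ ⊛ a₂)
    a₂² = homogeneous-⊛ 8 {a = a₂} {b = a₂} h₂ h₂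

    Y₀ Y₂ Y₄ V : Series
    Y₀ = a₀ ⊕ a₀ ⊛ a₀
    Y₂ = a₂ ⊕ const (+ 2) ⊛ (a₀ ⊛ a₂)
    Y₄ = a₂ ⊛ a₂
    V  = Y₀ ⊕ Y₂ ⊕ Y₄

    hY₀ : Homogeneous 8 0 Y₀
    hY₀ = homogeneous-⊕ 8 {a = a₀} {b = a₀ ⊛ a₀} h₀ a₀²

    hY₂ : Homogeneous 8 2 Y₂
    hY₂ = homogeneous-⊕ 8 {a = a₂} {b = const (+ 2) ⊛ (a₀ ⊛ a₂)} h₂ a₀a₂

  -- `V` is (a₀ + a₂) + (a₀ + a₂)² sorted by residue: the products fall on 0, 2 and 4 only.
  square-expansion : g ^ℕ 2 ≈ 𝟙 ⊕ const (+ 4) ⊛ V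
  square-expansion = ≈-trans (*-cong g≈ (*-congʳ g≈))
    (solve 2 (λ a b → (:1 :+ con (+ 2) :* (a :+ b)) :* ((:1 :+ con (+ 2) :* (a :+ b)) :* :1)
       := :1 :+ con (+ 4) :* ((a :+ a :* a) :+ (b :+ con (+ 2) :* (a :* b)) :+ b :* b))
      ≈-refl a₀ a₂)

  graded-base : Graded 1ℤ (g ^ℕ 2)
  graded-base = record
    { X₀ = Y₀ ; X₂ = Y₂ ; X₄ = Y₄ ; R = const 0ℤ ; h₀ = hY₀ ; h₂ = hY₂ ; h₄ = a₂²
    ; expansion = ≈-trans square-expansion
        (solve 1 (λ v → :1 :+ con (+ 4) :* v
          := :1 :+ con (+ 4) :* con 1ℤ :* (v :+ con (+ 4) :* con 0ℤ))
          ≈-refl V) }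

  even-power-expansion : ∀ {e} → e ℕ.≤ 1 →
    ∃[ W ] g ^ℕ (2 ℕ.* e) ≈ 𝟙 ⊕ const (+ 4) ⊛ W × VanishesAtSix W
  even-power-expansion z≤n       = const 0ℤ , solve 0 (:1 := :1 :+ con (+ 4) :* con 0ℤ) ≈-refl ,
    homogeneous-vanishes {a = const 0ℤ} (λ ()) (homogeneous-const 8 0ℤ)
  even-power-expansion (s≤s z≤n) = V , square-expansion ,
    vanishes-⊕ {Y₀ ⊕ Y₂} {Y₄} (vanishes-⊕ {Y₀} {Y₂}
      (homogeneous-vanishes {a = Y₀} (λ ()) hY₀) (homogeneous-vanishes {a = Y₂} (λ ()) hY₂))
      (homogeneous-vanishes {a = Y₄} (λ ()) a₂²)

  -- One factor `g` is split off and the rest is a power of g². The product of 2A with the deviation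
  -- of that power, a multiple of 4, is divisible by 8; the terms 1, 2A and 4X avoid the residue 6.
  odd-power-divisible : ∀ n → DivisibleAtSix (+ 8) (g ^ℕ (1 ℕ.+ 2 ℕ.* n))
  odd-power-divisible n = divisible-at-six {+ 8} {g ^ℕ (1 ℕ.+ 2 ℕ.* n)}
    {𝟙 ⊕ const (+ 2) ⊛ A ⊕ const (+ 4) ⊛ X} {const (+ 2) ⊛ R ⊕ A ⊛ (X ⊕ const (+ 4) ⊛ R)}
    (≈-trans (*-cong g≈ (≈-trans (^ℕ-* g 2 n) expansion))
      (solve 3 (λ a x r → (:1 :+ con (+ 2) :* a)
        :* (:1 :+ con (+ 4) :* con 1ℤ :* (x :+ con (+ 4) :* r))
         := :1 :+ con (+ 2) :* a :+ con (+ 4) :* x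
           :+ con (+ 8) :* (con (+ 2) :* r :+ a :* (x :+ con (+ 4) :* r)))
        ≈-refl A X R))
    (vanishes-⊕ {𝟙 ⊕ const (+ 2) ⊛ A} {const (+ 4) ⊛ X}
      (vanishes-⊕ {𝟙} {const (+ 2) ⊛ A} vanishes-𝟙 (vanishes-const (+ 2) {A} (vanishes-⊕ {a₀} {a₂}
        (homogeneous-vanishes {a = a₀} (λ ()) h₀) (homogeneous-vanishes {a = a₂} (λ ()) h₂))))
      (vanishes-const (+ 4) {X} (vanishes-⊕ {X₀ ⊕ X₂} {X₄} (vanishes-⊕ {X₀} {X₂}
        (homogeneous-vanishes {a = X₀} (λ ()) hX₀) (homogeneous-vanishes {a = X₂} (λ ()) hX₂))
        (homogeneous-vanishes {a = X₄} (λ ()) hX₄))))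
    where
    open Graded (graded-^ℕ graded-base n) renaming (h₀ to hX₀; h₂ to hX₂; h₄ to hX₄)
    A = a₀ ⊕ a₂
    X = X₀ ⊕ X₂ ⊕ X₄

  -- Here `k` is one less than in the theorem, and the modulus is half the final one; the missing 2
  -- comes from φ.
  power-divisible : ∀ k j e → e ℕ.≤ 1 →
    DivisibleAtSix ((+ 2) ^ (3 ℕ.+ k)) (g ^ℕ (7 ℕ.* (2 ℕ.^ k ℕ.* (1 ℕ.+ 2 ℕ.* j)) ℕ.+ 2 ℕ.* e))
  power-divisible zero    j e e≤1 = subst (λ m → DivisibleAtSix (+ 8) (g ^ℕ m)) (lemma j e)
    (odd-power-divisible (7 ℕ.* j ℕ.+ 3 ℕ.+ e))
    where
    lemma : ∀ j e → 1 ℕ.+ 2 ℕ.* (7 ℕ.* j ℕ.+ 3 ℕ.+ e) ≡ 7 ℕ.* (1 ℕ.* (1 ℕ.+ 2 ℕ.* j)) ℕ.+ 2 ℕ.* e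
    lemma = ℕ-solve-∀
  power-divisible (suc l) j e e≤1 n n≡6 with W , v≈ , W-van ← even-power-expansion e≤1 =
    -- The odd factor 7 (1 + 2j) is applied as an outer power of g^(2^(l+1)), which keeps p = 2^l in
    -- the grading.
    Signed.∣-trans (Signed.∣-reflexive (lemma ((+ 2) ^ l)))
      (subst (λ z → + 16 * (+ 2) ^ l ∣ₛ z) (coeff (≈-sym split) n)
        (graded-divisible (graded-^ℕ (graded-^2^ graded-base l) (7 ℕ.* (1 ℕ.+ 2 ℕ.* j)))
          v≈ W-van n n≡6))
    where
    lemma : ∀ p → + 2 * (+ 2 * (+ 2 * (+ 2 * p))) ≡ + 16 * p
    lemma = solve-∀
    exponent : ∀ x y → 7 ℕ.* (x ℕ.* y) ≡ x ℕ.* (7 ℕ.* y)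
    exponent = ℕ-solve-∀
    split : g ^ℕ (7 ℕ.* (2 ℕ.^ suc l ℕ.* (1 ℕ.+ 2 ℕ.* j)) ℕ.+ 2 ℕ.* e) ≈
            (g ^ℕ (2 ℕ.^ suc l)) ^ℕ (7 ℕ.* (1 ℕ.+ 2 ℕ.* j)) ⊛ g ^ℕ (2 ℕ.* e)
    split = ≈-trans (^ℕ-+ g (7 ℕ.* (2 ℕ.^ suc l ℕ.* (1 ℕ.+ 2 ℕ.* j))) (2 ℕ.* e))
      (*-congʳ {g ^ℕ (2 ℕ.* e)} (≈-trans
        (^ℕ-congʳ g (exponent (2 ℕ.^ suc l) (1 ℕ.+ 2 ℕ.* j)))
        (^ℕ-* g (2 ℕ.^ suc l) (7 ℕ.* (1 ℕ.+ 2 ℕ.* j)))))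

-- The congruence at exponents 8n + 7.

residue-six : ∀ n i j → i ℕ.+ j ≡ 8 ℕ.* n ℕ.+ 7 → i ℕ.% 8 ≡ 1 → j ℕ.% 8 ≡ 6
residue-six n i j i+j≡ i≡1 = begin
  j ℕ.% 8                        ≡⟨ ℕ.m%n%n≡m%n j 8 ⟨
  -- Adding 7 to i plays the part of subtracting it, as i has residue 1.
  (0 ℕ.+ j ℕ.% 8) ℕ.% 8          ≡⟨ cong (λ r → (r ℕ.+ j ℕ.% 8) ℕ.% 8) i+7≡0 ⟨
  ((i ℕ.+ 7) ℕ.% 8 ℕ.+ j ℕ.% 8) ℕ.% 8  ≡⟨ ℕ.%-distribˡ-+ (i ℕ.+ 7) j 8 ⟨
  (i ℕ.+ 7 ℕ.+ j) ℕ.% 8          ≡⟨ cong (ℕ._% 8) (rearrange i j) ⟩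
  (7 ℕ.+ (i ℕ.+ j)) ℕ.% 8        ≡⟨ cong (λ s → (7 ℕ.+ s) ℕ.% 8) i+j≡ ⟩
  (7 ℕ.+ (8 ℕ.* n ℕ.+ 7)) ℕ.% 8  ≡⟨ cong (ℕ._% 8) (multiple n) ⟩
  (14 ℕ.+ n ℕ.* 8) ℕ.% 8         ≡⟨ ℕ.[m+kn]%n≡m%n 14 n 8 ⟩
  6                              ∎
  where
  open ≡-Reasoning
  i+7≡0 : (i ℕ.+ 7) ℕ.% 8 ≡ 0
  i+7≡0 = trans (ℕ.%-distribˡ-+ i 7 8) (cong (λ r → (r ℕ.+ 7) ℕ.% 8) i≡1)
  rearrange : ∀ i j → i ℕ.+ 7 ℕ.+ j ≡ 7 ℕ.+ (i ℕ.+ j)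
  rearrange = ℕ-solve-∀
  multiple : ∀ n → 7 ℕ.+ (8 ℕ.* n ℕ.+ 7) ≡ 14 ℕ.+ n ℕ.* 8
  multiple = ℕ-solve-∀

odd-sum : ∀ n i j → i ℕ.+ j ≡ 8 ℕ.* n ℕ.+ 7 → i ℕ.% 2 ≡ 0 → ¬ j ℕ.% 2 ≡ 0
odd-sum n i j i+j≡ i≡0 j≡0 = ℕ.0≢1+n (begin
  0                                  ≡⟨ cong₂ (λ r s → (r ℕ.+ s) ℕ.% 2) i≡0 j≡0 ⟨
  (i ℕ.% 2 ℕ.+ j ℕ.% 2) ℕ.% 2        ≡⟨ ℕ.%-distribˡ-+ i j 2 ⟨
  (i ℕ.+ j) ℕ.% 2                    ≡⟨ cong (ℕ._% 2) i+j≡ ⟩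
  (8 ℕ.* n ℕ.+ 7) ℕ.% 2              ≡⟨ cong (ℕ._% 2) (multiple n) ⟩
  (1 ℕ.+ (4 ℕ.* n ℕ.+ 3) ℕ.* 2) ℕ.% 2  ≡⟨ ℕ.[m+kn]%n≡m%n 1 (4 ℕ.* n ℕ.+ 3) 2 ⟩
  1                                  ∎)
  where
  open ≡-Reasoning
  multiple : ∀ n → 8 ℕ.* n ℕ.+ 7 ≡ 1 ℕ.+ (4 ℕ.* n ℕ.+ 3) ℕ.* 2
  multiple = ℕ-solve-∀

∣0 : ∀ m → m ∣ₛ 0ℤ
∣0 m = divides 0ℤ refl

-- In a term with i + j = 8n + 7, an even i forces an odd j, where `g` vanishes. Otherwise i has
-- residue 1 and j residue 6, so `t` contributes the factor 2 and `g` the factor m.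
theta-⊛-divisible : ∀ {m t g} →
  (∀ n → t n ≡ 0ℤ ⊎ n ℕ.% 2 ≡ 0 ⊎ (n ℕ.% 8 ≡ 1 × + 2 ∣ₛ t n)) →
  Homogeneous 2 0 g → DivisibleAtSix m g → ∀ n → + 2 * m ∣ₛ (t ⊛ g) (8 ℕ.* n ℕ.+ 7)
theta-⊛-divisible {m} {t} {g} ht g-even g-div n =
  ⊛-closed (λ z → + 2 * m ∣ₛ z) (∣0 _) Signed.∣m∣n⇒∣m+n t g (8 ℕ.* n ℕ.+ 7) term
  where
  term : ∀ i j → i ℕ.+ j ≡ 8 ℕ.* n ℕ.+ 7 → + 2 * m ∣ₛ t i * g j
  term i j i+j≡ with ht i | g-even j
  ... | inj₁ tᵢ≡0 | _ = subst (λ z → + 2 * m ∣ₛ z) (sym (cong (_* g j) tᵢ≡0)) (∣0 _)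
  ... | inj₂ _ | inj₁ gⱼ≡0 =
    subst (λ z → + 2 * m ∣ₛ z) (sym (trans (cong (λ z → t i * z) gⱼ≡0) (ℤ.*-zeroʳ (t i)))) (∣0 _)
  ... | inj₂ (inj₁ i≡0) | inj₂ j≡0 = ⊥-elim (odd-sum n i j i+j≡ i≡0 j≡0)
  ... | inj₂ (inj₂ (i≡1 , 2∣tᵢ)) | inj₂ _ =
    Signed.∣-trans (Signed.*-monoʳ-∣ (+ 2) (g-div j (residue-six n i j i+j≡ i≡1)))
      (Signed.*-monoˡ-∣ (g j) 2∣tᵢ)

pos-^ : ∀ n → + (2 ℕ.^ n) ≡ (+ 2) ^ n
pos-^ zero    = refl
pos-^ (suc n) = trans (ℤ.pos-* 2 (2 ℕ.^ n)) (cong (λ z → + 2 * z) (pos-^ n))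

-- Modulo p the series `h` is 1, so `a` and `b` agree; no inverse of `h` enters.
divisible-numerator : ∀ p {a b h} N → OneMod p h → a ⊛ h ≈ b → p ∣ₛ b N → p ∣ₛ a N
divisible-numerator p {a} {b} {h} N (Z , h≈) ah≈b p∣b = subst (λ z → p ∣ₛ z) (sym a≡)
  (Signed.∣m∣n⇒∣m-n {p} {b N} p∣b (divides ((a ⊛ Z) N) (ℤ.*-comm p ((a ⊛ Z) N))))
  where
  expanded : a ⊕ const p ⊛ (a ⊛ Z) ≈ b
  expanded = ≈-trans
    (solve 3 (λ a p z → a :+ p :* (a :* z) := a :* (:1 :+ p :* z)) ≈-refl a (const p) Z)
    (≈-trans (*-congˡ {a} (≈-sym h≈)) ah≈b)
  a≡ : a N ≡ b N - p * (a ⊛ Z) N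
  a≡ = trans (isolate (a N) (p * (a ⊛ Z) N))
    (cong (λ t → t - p * (a ⊛ Z) N)
      (trans (cong (λ t → a N + t) (sym (const-⊛ p (a ⊛ Z) N))) (coeff expanded N)))
    where
    isolate : ∀ x y → x ≡ (x + y) - y
    isolate = solve-∀

-- Multiplying the last hypothesis by g^(7m) leaves g^(8m) on the left. As 8m is a multiple of
-- 2^(3+k), this is 1 modulo 2^(4+k), and the right side has natural exponents.
quotient-divisible : ∀ {a t g a₀ a₂} k j e n → e ℕ.≤ 1 → let m = 2 ℕ.^ k ℕ.* (1 ℕ.+ 2 ℕ.* j) in
  (∀ n → t n ≡ 0ℤ ⊎ n ℕ.% 2 ≡ 0 ⊎ (n ℕ.% 8 ≡ 1 × + 2 ∣ₛ t n)) →
  Homogeneous 2 0 g → Homogeneous 8 0 a₀ → Homogeneous 8 2 a₂ →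
  g ≈ 𝟙 ⊕ const (+ 2) ⊛ (a₀ ⊕ a₂) →
  a ⊛ g ^ℕ m ≈ t ⊛ g ^ℕ (2 ℕ.* e) →
  (+ 2) ^ (4 ℕ.+ k) ∣ₛ a (8 ℕ.* n ℕ.+ 7)
quotient-divisible {a} {t} {g} {a₀} {a₂} k j e n e≤1 ht g-even h₀ h₂ g≈ agᵐ≈ =
  divisible-numerator ((+ 2) ^ (4 ℕ.+ k)) {a} {t ⊛ G} {g ^ℕ (m ℕ.+ 7 ℕ.* m)}
    (8 ℕ.* n ℕ.+ 7) g⁸ᵐ ag⁸ᵐ≈
    (theta-⊛-divisible {(+ 2) ^ (3 ℕ.+ k)} {t} {G} ht (even-^ℕ g-even (7 ℕ.* m ℕ.+ 2 ℕ.* e))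
      (power-divisible h₀ h₂ g≈ k j e e≤1) n)
  where
  open ≈-Reasoning
  m = 2 ℕ.^ k ℕ.* (1 ℕ.+ 2 ℕ.* j)
  G = g ^ℕ (7 ℕ.* m ℕ.+ 2 ℕ.* e)

  exponent : ∀ x y → 2 ℕ.* (2 ℕ.* (2 ℕ.* x)) ℕ.* y ≡ x ℕ.* y ℕ.+ 7 ℕ.* (x ℕ.* y)
  exponent = ℕ-solve-∀

  g⁸ᵐ : OneMod ((+ 2) ^ (4 ℕ.+ k)) (g ^ℕ (m ℕ.+ 7 ℕ.* m))
  g⁸ᵐ = oneMod-≈ ((+ 2) ^ (4 ℕ.+ k))
    (≈-trans (≈-sym (^ℕ-* g (2 ℕ.^ (3 ℕ.+ k)) (1 ℕ.+ 2 ℕ.* j)))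
      (^ℕ-congʳ g (exponent (2 ℕ.^ k) (1 ℕ.+ 2 ℕ.* j))))
    (oneMod-^ℕ ((+ 2) ^ (4 ℕ.+ k)) (oneMod-^2^ (a₀ ⊕ a₂ , g≈) (3 ℕ.+ k)) (1 ℕ.+ 2 ℕ.* j))

  ag⁸ᵐ≈ : a ⊛ g ^ℕ (m ℕ.+ 7 ℕ.* m) ≈ t ⊛ G
  ag⁸ᵐ≈ = begin
    a ⊛ g ^ℕ (m ℕ.+ 7 ℕ.* m)                 ≈⟨ *-congˡ {a} (^ℕ-+ g m (7 ℕ.* m)) ⟩
    a ⊛ (g ^ℕ m ⊛ g ^ℕ (7 ℕ.* m))            ≈⟨ *-assoc a (g ^ℕ m) (g ^ℕ (7 ℕ.* m)) ⟨
    a ⊛ g ^ℕ m ⊛ g ^ℕ (7 ℕ.* m)              ≈⟨ *-congʳ {g ^ℕ (7 ℕ.* m)} agᵐ≈ ⟩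
    t ⊛ g ^ℕ (2 ℕ.* e) ⊛ g ^ℕ (7 ℕ.* m)      ≈⟨ *-assoc t (g ^ℕ (2 ℕ.* e)) (g ^ℕ (7 ℕ.* m)) ⟩
    t ⊛ (g ^ℕ (2 ℕ.* e) ⊛ g ^ℕ (7 ℕ.* m))
      ≈⟨ *-congˡ {t} (≈-trans (*-comm (g ^ℕ (2 ℕ.* e)) (g ^ℕ (7 ℕ.* m)))
           (≈-sym (^ℕ-+ g (7 ℕ.* m) (2 ℕ.* e)))) ⟩
    t ⊛ G                                    ∎

ā-divisible : ∀ c k j e n → e ℕ.≤ 1 → c + + (1 ℕ.+ 2 ℕ.* e) ≡ + (2 ℕ.^ k ℕ.* (1 ℕ.+ 2 ℕ.* j)) →
              (+ 2) ^ (4 ℕ.+ k) ∣ₛ ā c (8 ℕ.* n ℕ.+ 7)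
ā-divisible c k j e n e≤1 c≡ =
  quotient-divisible {ā c} {φ} {u} {S₀} {S₂} k j e n e≤1 φ-coefficient u-even
  (select-homogeneous 0 U.S∞) (select-homogeneous 2 U.S∞) u-split
  (ā-theta c (2 ℕ.^ k ℕ.* (1 ℕ.+ 2 ℕ.* j)) e c≡)

-- The indices c of the two families

-- The remainder is 0 or 1, and 1 would make 2 divide 1.
[2*x]/2≡x : ∀ x → (+ 2 * x) / + 2 ≡ x
[2*x]/2≡x x = sym (ℤ.*-cancelʳ-≡ x q (+ 2)
  (trans (ℤ.*-comm x (+ 2)) (go (ℤ.n%d<d (+ 2 * x) (+ 2)) (ℤ.a≡a%n+[a/n]*n (+ 2 * x) (+ 2)))))
  where
  q = (+ 2 * x) / + 2
  go : ∀ {r} → r ℕ.< 2 → + 2 * x ≡ + r + q * + 2 → + 2 * x ≡ q * + 2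
  go {0} _ eq = trans eq (ℤ.+-identityˡ (q * + 2))
  go {1} _ eq with s≤s () ← ℕ.∣⇒≤ (Signed.∣⇒∣ᵤ (Signed.∣m+n∣n⇒∣m {+ 2} {1ℤ} {q * + 2}
    (divides x (trans (sym eq) (ℤ.*-comm (+ 2) x))) (divides q refl)))
  go {suc (suc r)} (s≤s (s≤s ())) eq

half : ∀ p d → (+ 2 * p - + 2 * d) / + 2 ≡ p - d
half p d = trans (cong (λ t → t / + 2) (lemma p d)) ([2*x]/2≡x (p - d))
  where
  lemma : ∀ p d → + 2 * p - + 2 * d ≡ + 2 * (p - d)
  lemma = solve-∀

-- The theorem's k is k + 1 here. The values d = 3 and d = 1 give the numerators with 6 and 2, and d
-- = 1 + 2e for e = 1 and e = 0.
index : ∀ k i d →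
  + 2 * (+ 2) ^ k * + i + (+ 2 * (+ 2) ^ k - + 2 * d) / + 2 + d ≡ + (2 ℕ.^ k ℕ.* (1 ℕ.+ 2 ℕ.* i))
index k i d = begin
  + 2 * p * + i + (+ 2 * p - + 2 * d) / + 2 + d  ≡⟨ cong (λ t → + 2 * p * + i + t + d) (half p d) ⟩
  + 2 * p * + i + (p - d) + d                    ≡⟨ lemma p (+ i) d ⟩
  p * (+ 1 + + 2 * + i)
    ≡⟨ cong₂ _*_ (pos-^ k) (cong (λ t → + 1 + t) (ℤ.pos-* 2 i)) ⟨
  + (2 ℕ.^ k) * + (1 ℕ.+ 2 ℕ.* i)                ≡⟨ ℤ.pos-* (2 ℕ.^ k) (1 ℕ.+ 2 ℕ.* i) ⟨
  + (2 ℕ.^ k ℕ.* (1 ℕ.+ 2 ℕ.* i))                ∎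
  where
  open ≡-Reasoning
  p = (+ 2) ^ k
  lemma : ∀ p i d → + 2 * p * i + (p - d) + d ≡ p * (+ 1 + + 2 * i)
  lemma = solve-∀

theorem1p8 : (n k i : ℕ) → 1 ℕ.≤ k →
    ((+ 2) ^ (k ℕ.+ 3) ∣ ā ((+ 2) ^ k * (+ i) + ((+ 2) ^ k - (+ 6)) / (+ 2)) (8 ℕ.* n ℕ.+ 7))
    × ((+ 2) ^ (k ℕ.+ 3) ∣ ā ((+ 2) ^ k * (+ i) + ((+ 2) ^ k - (+ 2)) / (+ 2)) (8 ℕ.* n ℕ.+ 7))
theorem1p8 n (suc k) i _ =
  divisible ((+ 2) ^ suc k * + i + ((+ 2) ^ suc k - + 6) / + 2) 1 ℕ.≤-refl (index k i (+ 3)) ,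
  divisible ((+ 2) ^ suc k * + i + ((+ 2) ^ suc k - + 2) / + 2) 0 z≤n (index k i (+ 1))
  where
  divisible : ∀ c e → e ℕ.≤ 1 → c + + (1 ℕ.+ 2 ℕ.* e) ≡ + (2 ℕ.^ k ℕ.* (1 ℕ.+ 2 ℕ.* i)) →
              (+ 2) ^ (suc k ℕ.+ 3) ∣ ā c (8 ℕ.* n ℕ.+ 7)
  divisible c e e≤1 c≡ = subst (λ l → (+ 2) ^ l ∣ ā c (8 ℕ.* n ℕ.+ 7)) (cong suc (ℕ.+-comm 3 k))
    (Signed.∣⇒∣ᵤ (ā-divisible c k i e n e≤1 c≡))
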